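{- Let $d\geq 2$ and $p\geq 1$ be integers, and let $\mathbb{P}_k^{(d)}$ be the uniform probability measure on $\mathcal{C}_k^{(d)}$. Then, with $\kappa_{p,d}:=(2pd^pe^p)^{ -1}$, $$\mathbb{P}_k^{(d)}(T\text{ is not }p\text{ -perfect})\leq e^{ -\kappa_{p,d}(k-p)_+}\qquad\text{for all }k\in\mathbb{N},$$ where $x_+:=\max(x,0)$.
   Context: A $d$-Catalan tree is a rooted planar tree in which every vertex has either $0$ or $d$ children; $\mathcal{C}_k^{(d)}$ denotes the set of such trees with $k$ internal vertices. A tree $T\in\mathcal{C}_k^{(d)}$ is $p$-perfect if it contains an ancestral path $(v_0,\dots,v_p)$ (each $v_i$ a child of $v_{i-1}$) such that each of the $(d-1)p$ siblings of $v_1,\dots,v_p$ is a leaf. -}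

module Defs where

open import Data.Nat using (ℕ; zero; suc; _+_)
open import Data.Fin using (Fin)
open import Data.Vec using (Vec; []; _∷_; lookup)
open import Data.Product using (Σ; _×_)
open import Data.Empty using (⊥)
open import Data.Unit using (⊤)
open import Data.Integer using (+_)
open import Relation.Binary.PropositionalEquality using (_≡_; _≢_)
import Data.Rational as Q

data Tree (d : ℕ) : Set where
  leaf : Tree d
  node : Vec (Tree d) d → Tree d

mutual
  internal : ∀ {d} → Tree d → ℕ
  internal leaf      = 0
  internal (node ts) = suc (internalVec ts)

  internalVec : ∀ {d n} → Vec (Tree d) n → ℕ
  internalVec []       = 0
  internalVec (t ∷ ts) = internal t + internalVec ts

data Subtree {d : ℕ} (S : Tree d) : Tree d → Set where
  here  : Subtree S S
  there : ∀ {ts : Vec (Tree d) d} (i : Fin d) →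
          Subtree S (lookup ts i) → Subtree S (node ts)

-- PerfPath p T : there is an ancestral path (v0,…,vp) with v0 the root of T,
-- each v(i) a child of v(i-1), and all siblings of v1,…,vp are leaves.
PerfPath : ∀ {d} → ℕ → Tree d → Set
PerfPath zero    T         = ⊤
PerfPath (suc p) leaf      = ⊥
PerfPath (suc p) (node ts) =
  Σ (Fin _) λ i → ((j : Fin _) → j ≢ i → lookup ts j ≡ leaf) × PerfPath p (lookup ts i)

Perfect : ∀ {d} → ℕ → Tree d → Set
Perfect {d} p T = Σ (Tree d) λ S → Subtree S T × PerfPath p S

ℕtoℚ : ℕ → Q.ℚ
ℕtoℚ n = + n Q./ 1

expTerm : Q.ℚ → ℕ → Q.ℚ
expTerm x zero    = Q.1ℚ
expTerm x (suc i) = expTerm x i Q.* (x Q.* (+ 1 Q./ suc i))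

-- expPartial x n = Σ_{i=0}^{n} x^i / i!  (partial sums of the exponential
-- series; for x ≥ 0 these increase to e^x, so e^x = sup_n expPartial x n).
expPartial : Q.ℚ → ℕ → Q.ℚ
expPartial x zero    = expTerm x zero
expPartial x (suc n) = expPartial x n Q.+ expTerm x (suc n)

{-# OPTIONS --safe #-}
-- Write a d-ary tree with k internal vertices as its preorder word of N = dk + 1
-- letters, k of them true. By the cycle lemma the N rotations of the codes of
-- all trees are exactly the binom(N, k) words with k letters true, without
-- repetition, and a rotation of the code of a tree that is not p-perfect avoids
-- the factor π = (true false^(d-1))^p, the code of a path along last children.
-- So it suffices to count the words whose last ⌊k/p⌋ blocks of length dp all
-- differ from π; let g_m be the number of words whose last m blocks do.
-- With f letters left over, g_m is a coefficient of (1 + z)^f ((1 + z)^(dp) - z^p)^m: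
-- the logarithmic derivative of this is so close to that of (1 + z)^(f + mdp) that
-- consecutive coefficients have ratios known up to a relative error O(m/k).
-- Hence removing one copy of π costs at most a factor 2 (d^d / (d-1)^(d-1))^p, i.e.
-- g_(m+1) ≤ (1 - ε) g_m with 1/ε ≤ 2 d^p e^p.
-- For p = 1 every tree other than a single leaf is perfect.
module Submission where

open import Defs

-- Partial sums of the exponential series

-- If the letters were independent, `true` with probability 1/d, a block would equal π with
-- probability ((d-1)^(d-1) / d^d)^p, and (d/(d-1))^((d-1)p) ≤ e^p bounds its inverse by d^p e^p.
-- Fixing the number of letters `true` destroys the independence; the factor 2 in κ pays for this,
-- as 4/3 · 3/2, and the factor p is the price of testing only ⌊k/p⌋ disjoint blocks. The
-- logarithmic derivative is controlled one block at a time: in (1 + z)^(dp) the coefficients at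
-- z^(p-1) and z^p are so large that taking away z^p disturbs it by at most 1/d. This rests on
-- binom(dp, p-1) ≥ dp, which fails for p = 1; hence the separate treatment of that case. As mp ≤ k,
-- the disturbances of m blocks add up to at most k/(dp). The counting stays in the natural numbers,
-- so differences and quotients appear as sums and cross products.

module Exponential where
  open import Data.Nat as ℕ using (ℕ; zero; suc)
  import Data.Nat.Properties as ℕ
  import Data.Integer as ℤ
  import Data.Integer.Properties as ℤ
  open import Data.Rational using (ℚ; 0ℚ; 1ℚ; _+_; _*_; _-_; -_; _≤_; _<_; *<*; toℚᵘ; nonNegative; Positive; positive)
  import Data.Rational as Q
  open import Data.Rational.Properties
  import Data.Rational.Unnormalised as ℚᵘ
  import Data.Rational.Unnormalised.Properties as ℚᵘ
  open import Relation.Nullary.Decidable using (dec⇒maybe)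
  open import Relation.Binary.PropositionalEquality
  import Tactic.RingSolver as Ring
  open import Tactic.RingSolver.Core.AlmostCommutativeRing using (AlmostCommutativeRing; fromCommutativeRing)

  ℚ-ring : AlmostCommutativeRing _ _
  ℚ-ring = fromCommutativeRing +-*-commutativeRing (λ x → dec⇒maybe (0ℚ ≟ x))

  toℚᵘ-ℕtoℚ : ∀ n → toℚᵘ (ℕtoℚ n) ℚᵘ.≃ ℚᵘ.mkℚᵘ (ℤ.+ n) 0
  toℚᵘ-ℕtoℚ n = toℚᵘ-fromℚᵘ (ℚᵘ.mkℚᵘ (ℤ.+ n) 0)

  ℕtoℚ-+ : ∀ m n → ℕtoℚ (m ℕ.+ n) ≡ ℕtoℚ m + ℕtoℚ n
  ℕtoℚ-+ m n = toℚᵘ-injective (ℚᵘ.≃-trans (toℚᵘ-ℕtoℚ (m ℕ.+ n)) (ℚᵘ.≃-sym (ℚᵘ.≃-trans (toℚᵘ-homo-+ (ℕtoℚ m) (ℕtoℚ n))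
    (ℚᵘ.≃-trans (ℚᵘ.+-cong (toℚᵘ-ℕtoℚ m) (toℚᵘ-ℕtoℚ n))
      (ℚᵘ.*≡* (cong (ℤ._* ℤ.1ℤ) (cong₂ ℤ._+_ (ℤ.*-identityʳ (ℤ.+ m)) (ℤ.*-identityʳ (ℤ.+ n)))))))))

  ℕtoℚ-* : ∀ m n → ℕtoℚ (m ℕ.* n) ≡ ℕtoℚ m * ℕtoℚ n
  ℕtoℚ-* m n = toℚᵘ-injective (ℚᵘ.≃-trans (toℚᵘ-ℕtoℚ (m ℕ.* n)) (ℚᵘ.≃-sym (ℚᵘ.≃-trans (toℚᵘ-homo-* (ℕtoℚ m) (ℕtoℚ n))
    (ℚᵘ.≃-trans (ℚᵘ.*-cong (toℚᵘ-ℕtoℚ m) (toℚᵘ-ℕtoℚ n))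
      (ℚᵘ.*≡* (cong (ℤ._* ℤ.1ℤ) (sym (ℤ.pos-* m n))))))))

  ℕtoℚ-mono : ∀ {m n} → m ℕ.≤ n → ℕtoℚ m ≤ ℕtoℚ n
  ℕtoℚ-mono {m} {n} m≤n = toℚᵘ-cancel-≤ (ℚᵘ.≤-trans (ℚᵘ.≤-reflexive (toℚᵘ-ℕtoℚ m))
    (ℚᵘ.≤-trans (ℚᵘ.*≤* (ℤ.*-monoʳ-≤-nonNeg ℤ.1ℤ (ℤ.+≤+ m≤n))) (ℚᵘ.≤-reflexive (ℚᵘ.≃-sym (toℚᵘ-ℕtoℚ n)))))

  0≤ℕtoℚ : ∀ n → 0ℚ ≤ ℕtoℚ n
  0≤ℕtoℚ n = ℕtoℚ-mono {0} {n} ℕ.z≤n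

  ℕtoℚ-pos : ∀ {n} → 1 ℕ.≤ n → Positive (ℕtoℚ n)
  ℕtoℚ-pos 1≤n = positive (<-≤-trans (*<* (ℤ.+<+ (ℕ.s≤s ℕ.z≤n))) (ℕtoℚ-mono 1≤n))

  1/suc : ℕ → ℚ
  1/suc i = ℤ.+ 1 Q./ suc i

  1/suc-inverse : ∀ i → ℕtoℚ (suc i) * 1/suc i ≡ 1ℚ
  1/suc-inverse i = toℚᵘ-injective (ℚᵘ.≃-trans (toℚᵘ-homo-* (ℕtoℚ (suc i)) (1/suc i))
    (ℚᵘ.≃-trans (ℚᵘ.*-cong (toℚᵘ-ℕtoℚ (suc i)) (toℚᵘ-fromℚᵘ (ℚᵘ.mkℚᵘ (ℤ.+ 1) i)))
      (ℚᵘ.*≡* (cong ℤ.+_ (eq i)))))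
    where
    open import Data.Nat.Tactic.RingSolver using (solve-∀)
    eq : ∀ i → suc i ℕ.* 1 ℕ.* 1 ≡ 1 ℕ.* (1 ℕ.* suc i)
    eq = solve-∀

  *-monoʳ : ∀ {r p q} → 0ℚ ≤ r → p ≤ q → r * p ≤ r * q
  *-monoʳ {r} 0≤r = *-monoˡ-≤-nonNeg r {{nonNegative 0≤r}}

  *-monoˡ : ∀ {r p q} → 0ℚ ≤ r → p ≤ q → p * r ≤ q * r
  *-monoˡ {r} 0≤r = *-monoʳ-≤-nonNeg r {{nonNegative 0≤r}}

  0≤* : ∀ {p q} → 0ℚ ≤ p → 0ℚ ≤ q → 0ℚ ≤ p * q
  0≤* {p} {q} 0≤p 0≤q = ≤-trans (≤-reflexive (sym (*-zeroʳ p))) (*-monoʳ 0≤p 0≤q)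

  0≤+ : ∀ {p q} → 0ℚ ≤ p → 0ℚ ≤ q → 0ℚ ≤ p + q
  0≤+ 0≤p 0≤q = ≤-trans (≤-reflexive (sym (+-identityˡ 0ℚ))) (+-mono-≤ 0≤p 0≤q)

  p≤p+q : ∀ {p q} → 0ℚ ≤ q → p ≤ p + q
  p≤p+q {p} 0≤q = ≤-trans (≤-reflexive (sym (+-identityʳ p))) (+-monoʳ-≤ p 0≤q)

  0≤1/suc : ∀ i → 0ℚ ≤ 1/suc i
  0≤1/suc i = nonNegative⁻¹ (1/suc i) {{normalize-nonNeg 1 (suc i)}}

  0≤expTerm : ∀ {x} i → 0ℚ ≤ x → 0ℚ ≤ expTerm x i
  0≤expTerm zero    0≤x = nonNegative⁻¹ 1ℚ
  0≤expTerm (suc i) 0≤x = 0≤* (0≤expTerm i 0≤x) (0≤* 0≤x (0≤1/suc i))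

  expTerm-suc : ∀ x i → expTerm x i * x ≡ ℕtoℚ (suc i) * expTerm x (suc i)
  expTerm-suc x i = begin
    t * x                                      ≡⟨ lem₁ (t * x) ⟩
    1ℚ * (t * x)                               ≡⟨ cong (_* (t * x)) (sym (1/suc-inverse i)) ⟩
    ℕtoℚ (suc i) * 1/suc i * (t * x)           ≡⟨ lem₂ (ℕtoℚ (suc i)) (1/suc i) t x ⟩
    ℕtoℚ (suc i) * (t * (x * 1/suc i))         ∎
    where
    open ≡-Reasoning
    t = expTerm x i
    lem₁ : ∀ u → u ≡ 1ℚ * u
    lem₁ u = sym (*-identityˡ u)
    lem₂ : ∀ n c t x → n * c * (t * x) ≡ n * (t * (x * c))
    lem₂ = Ring.solve-∀ ℚ-ring

  expTerm-0 : ∀ i → expTerm 0ℚ (suc i) ≡ 0ℚ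
  expTerm-0 i = trans (cong (expTerm 0ℚ i *_) (*-zeroˡ (1/suc i))) (*-zeroʳ (expTerm 0ℚ i))

  1+i/suc : ∀ i → 1/suc (suc i) + ℕtoℚ (suc i) * 1/suc (suc i) ≡ 1ℚ
  1+i/suc i = trans (lem (1/suc (suc i)) (ℕtoℚ (suc i)))
    (trans (cong (_* 1/suc (suc i)) (sym (ℕtoℚ-+ 1 (suc i)))) (1/suc-inverse (suc i)))
    where
    lem : ∀ c n → c + n * c ≡ (1ℚ + n) * c
    lem = Ring.solve-∀ ℚ-ring

  module _ {x y : ℚ} (0≤x : 0ℚ ≤ x) (0≤y : 0ℚ ≤ y) where

    private
      s = y + x
      0≤s : 0ℚ ≤ s
      0≤s = 0≤+ 0≤y 0≤x

    -- This is s^(i+1) - y^(i+1) ≤ (i+1) x s^i divided by (i+1)!, the mean value bound at the larger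
    -- endpoint; `expTerm-+-≥` is the one at the smaller endpoint.
    expTerm-+-≤ : ∀ i → expTerm s (suc i) ≤ expTerm y (suc i) + x * expTerm s i
    expTerm-+-≤ zero    = ≤-reflexive (lem y x)
      where
      lem : ∀ y x → 1ℚ * ((y + x) * 1ℚ) ≡ 1ℚ * (y * 1ℚ) + x * 1ℚ
      lem = Ring.solve-∀ ℚ-ring
    expTerm-+-≤ (suc i) = begin
      t' * (s * c)                                  ≡⟨ lem₁ t' y x c ⟩
      t' * (y * c) + x * t' * c                     ≤⟨ +-monoˡ-≤ _ (*-monoˡ (0≤* 0≤y (0≤1/suc (suc i))) (expTerm-+-≤ i)) ⟩
      (u + x * t) * (y * c) + x * t' * c            ≤⟨ +-monoˡ-≤ (x * t' * c) (≤-trans (p≤p+q {(u + x * t) * (y * c)} (0≤* (0≤* 0≤x (0≤expTerm i 0≤s)) (0≤* 0≤x (0≤1/suc (suc i)))))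
                                                         (≤-reflexive (lem₂ u x t y c))) ⟩
      u * (y * c) + x * (t * s) * c + x * t' * c    ≡⟨ cong (λ z → u * (y * c) + x * z * c + x * t' * c) (expTerm-suc s i) ⟩
      u * (y * c) + x * (n * t') * c + x * t' * c   ≡⟨ lem₃ (u * (y * c)) x n t' c ⟩
      u * (y * c) + x * t' * (c + n * c)            ≡⟨ cong (λ z → u * (y * c) + x * t' * z) (1+i/suc i) ⟩
      u * (y * c) + x * t' * 1ℚ                     ≡⟨ cong (u * (y * c) +_) (*-identityʳ (x * t')) ⟩
      u * (y * c) + x * t'                          ∎
      where
      open ≤-Reasoning
      t = expTerm s i
      t' = expTerm s (suc i)
      u = expTerm y (suc i)
      c = 1/suc (suc i)
      n = ℕtoℚ (suc i)
      lem₁ : ∀ t y x c → t * ((y + x) * c) ≡ t * (y * c) + x * t * c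
      lem₁ = Ring.solve-∀ ℚ-ring
      lem₂ : ∀ u x t y c → (u + x * t) * (y * c) + x * t * (x * c) ≡ u * (y * c) + x * (t * (y + x)) * c
      lem₂ = Ring.solve-∀ ℚ-ring
      lem₃ : ∀ v x n t c → v + x * (n * t) * c + x * t * c ≡ v + x * t * (c + n * c)
      lem₃ = Ring.solve-∀ ℚ-ring

    expTerm-+-≥ : ∀ i → expTerm y (suc i) + x * expTerm y i ≤ expTerm s (suc i)
    expTerm-+-≥ zero    = ≤-reflexive (lem y x)
      where
      lem : ∀ y x → 1ℚ * (y * 1ℚ) + x * 1ℚ ≡ 1ℚ * ((y + x) * 1ℚ)
      lem = Ring.solve-∀ ℚ-ring
    expTerm-+-≥ (suc i) = begin
      u' * (y * c) + x * u'                                   ≡⟨ cong (u' * (y * c) +_) (sym (*-identityʳ (x * u'))) ⟩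
      u' * (y * c) + x * u' * 1ℚ                              ≡⟨ cong (λ z → u' * (y * c) + x * u' * z) (sym (1+i/suc i)) ⟩
      u' * (y * c) + x * u' * (c + n * c)                     ≡⟨ lem₁ (u' * (y * c)) x u' c n ⟩
      u' * (y * c) + x * u' * c + x * (n * u') * c            ≡⟨ cong (λ z → u' * (y * c) + x * u' * c + x * z * c) (sym (expTerm-suc y i)) ⟩
      u' * (y * c) + x * u' * c + x * (u * y) * c             ≤⟨ p≤p+q (0≤* (0≤* 0≤x (0≤expTerm i 0≤y)) (0≤* 0≤x (0≤1/suc (suc i)))) ⟩
      u' * (y * c) + x * u' * c + x * (u * y) * c + x * u * (x * c) ≡⟨ lem₂ u' y c x u ⟩
      (u' + x * u) * (s * c)                                  ≤⟨ *-monoˡ (0≤* 0≤s (0≤1/suc (suc i))) (expTerm-+-≥ i) ⟩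
      expTerm s (suc i) * (s * c)                             ∎
      where
      open ≤-Reasoning
      u = expTerm y i
      u' = expTerm y (suc i)
      c = 1/suc (suc i)
      n = ℕtoℚ (suc i)
      lem₁ : ∀ v x t c n → v + x * t * (c + n * c) ≡ v + x * t * c + x * (n * t) * c
      lem₁ = Ring.solve-∀ ℚ-ring
      lem₂ : ∀ v y c x u → v * (y * c) + x * v * c + x * (u * y) * c + x * u * (x * c) ≡ (v + x * u) * ((y + x) * c)
      lem₂ = Ring.solve-∀ ℚ-ring

    expPartial-+-suc-≤ : ∀ m → expPartial s (suc m) ≤ expPartial y (suc m) + x * expPartial s m
    expPartial-+-suc-≤ zero    = ≤-trans (+-monoʳ-≤ 1ℚ (expTerm-+-≤ 0)) (≤-reflexive (sym (+-assoc 1ℚ (expTerm y 1) (x * 1ℚ))))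
    expPartial-+-suc-≤ (suc m) = ≤-trans (+-mono-≤ (expPartial-+-suc-≤ m) (expTerm-+-≤ (suc m)))
      (≤-reflexive (lem (expPartial y (suc m)) x (expPartial s m) (expTerm y (suc (suc m))) (expTerm s (suc m))))
      where
      lem : ∀ a x b c d → a + x * b + (c + x * d) ≡ a + c + x * (b + d)
      lem = Ring.solve-∀ ℚ-ring

    -- The truncated form of (1 - x) e^(y+x) ≤ e^y. All sums are cut at the same m, so that the
    -- bound can be iterated.
    expPartial-+-≤ : ∀ m → expPartial s m ≤ expPartial y m + x * expPartial s m
    expPartial-+-≤ zero    = p≤p+q (0≤* 0≤x (nonNegative⁻¹ 1ℚ))
    expPartial-+-≤ (suc m) = ≤-trans (expPartial-+-suc-≤ m)
      (+-monoʳ-≤ (expPartial y (suc m)) (*-monoʳ 0≤x (p≤p+q (0≤expTerm (suc m) 0≤s))))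

    -- The truncated form of (1 + x) e^y ≤ e^(y+x). The factor x raises the degree by 1, so its sum
    -- is cut one index earlier.
    expPartial-+-≥ : ∀ m → expPartial y (suc m) + x * expPartial y m ≤ expPartial s (suc m)
    expPartial-+-≥ zero    = ≤-trans (≤-reflexive (+-assoc 1ℚ (expTerm y 1) (x * 1ℚ))) (+-monoʳ-≤ 1ℚ (expTerm-+-≥ 0))
    expPartial-+-≥ (suc m) = ≤-trans
      (≤-reflexive (lem (expPartial y (suc m)) x (expPartial y m) (expTerm y (suc (suc m))) (expTerm y (suc m))))
      (+-mono-≤ (expPartial-+-≥ m) (expTerm-+-≥ (suc m)))
      where
      lem : ∀ a x b c d → a + c + x * (b + d) ≡ a + x * b + (c + x * d)
      lem = Ring.solve-∀ ℚ-ring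

  0≤expPartial : ∀ {x} m → 0ℚ ≤ x → 0ℚ ≤ expPartial x m
  0≤expPartial zero    0≤x = nonNegative⁻¹ 1ℚ
  0≤expPartial (suc m) 0≤x = 0≤+ (0≤expPartial m 0≤x) (0≤expTerm (suc m) 0≤x)

  expPartial-0 : ∀ m → expPartial 0ℚ m ≡ 1ℚ
  expPartial-0 zero    = refl
  expPartial-0 (suc m) = trans (cong₂ _+_ (expPartial-0 m) (expTerm-0 m)) (+-identityʳ 1ℚ)

  expPartial-mono : ∀ {y z} m → 0ℚ ≤ y → y ≤ z → expPartial y m ≤ expPartial z m
  expPartial-mono zero    0≤y y≤z = ≤-refl
  expPartial-mono {y} {z} (suc m) 0≤y y≤z = subst (λ w → expPartial y (suc m) ≤ expPartial w (suc m)) (eq y z)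
    (≤-trans (p≤p+q (0≤* 0≤z-y (0≤expPartial m 0≤y))) (expPartial-+-≥ 0≤z-y 0≤y m))
    where
    0≤z-y : 0ℚ ≤ z - y
    0≤z-y = ≤-trans (≤-reflexive (sym (+-inverseʳ y))) (+-monoˡ-≤ (- y) y≤z)
    eq : ∀ y z → y + (z - y) ≡ z
    eq y z = trans (cong (y +_) (+-comm z (- y))) (trans (sym (+-assoc y (- y) z))
               (trans (cong (_+ z) (+-inverseʳ y)) (+-identityˡ z)))

  -- This is (1 + x)^r ≤ e^(rx) for x = 1/(D+1). Each factor 1 + x moves the argument by x and uses
  -- one more term of the series.
  suc^≤expPartial : ∀ D r → ℕtoℚ (suc (suc D) ℕ.^ r) ≤ ℕtoℚ (suc D ℕ.^ r) * expPartial (ℕtoℚ r * 1/suc D) r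
  suc^≤expPartial D zero    = ≤-refl
  suc^≤expPartial D (suc r) = begin
    ℕtoℚ (suc (suc D) ℕ.* suc (suc D) ℕ.^ r)       ≡⟨ ℕtoℚ-* (suc (suc D)) (suc (suc D) ℕ.^ r) ⟩
    ℕtoℚ (suc (suc D)) * ℕtoℚ (suc (suc D) ℕ.^ r)  ≤⟨ *-monoʳ (0≤ℕtoℚ (suc (suc D))) (suc^≤expPartial D r) ⟩
    ℕtoℚ (suc (suc D)) * (b * e)                   ≡⟨ cong (_* (b * e)) 2+D ⟩
    (a + a * x) * (b * e)                          ≡⟨ lem₁ a x b e ⟩
    a * b * (e + x * e)                            ≤⟨ *-monoʳ (0≤* (0≤ℕtoℚ (suc D)) (0≤ℕtoℚ (suc D ℕ.^ r)))
                                                        (≤-trans (+-monoˡ-≤ (x * e) (p≤p+q {e} (0≤expTerm (suc r) 0≤y)))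
                                                          (expPartial-+-≥ 0≤x 0≤y r)) ⟩
    a * b * expPartial (y + x) (suc r)             ≡⟨ cong₂ _*_ (sym (ℕtoℚ-* (suc D) (suc D ℕ.^ r))) (cong (λ z → expPartial z (suc r)) y+x) ⟩
    ℕtoℚ (suc D ℕ.* suc D ℕ.^ r) * expPartial (ℕtoℚ (suc r) * x) (suc r) ∎
    where
    open ≤-Reasoning
    x = 1/suc D
    y = ℕtoℚ r * x
    a = ℕtoℚ (suc D)
    b = ℕtoℚ (suc D ℕ.^ r)
    e = expPartial y r
    0≤x : 0ℚ ≤ x
    0≤x = 0≤1/suc D
    0≤y : 0ℚ ≤ y
    0≤y = 0≤* (0≤ℕtoℚ r) 0≤x
    2+D : ℕtoℚ (suc (suc D)) ≡ a + a * x
    2+D = trans (ℕtoℚ-+ 1 (suc D)) (trans (+-comm 1ℚ a) (cong (a +_) (sym (1/suc-inverse D))))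
    y+x : y + x ≡ ℕtoℚ (suc r) * x
    y+x = trans (lem (ℕtoℚ r) x) (cong (_* x) (sym (ℕtoℚ-+ 1 r)))
      where
      lem : ∀ r x → r * x + x ≡ (1ℚ + r) * x
      lem = Ring.solve-∀ ℚ-ring
    lem₁ : ∀ a x b e → (a + a * x) * (b * e) ≡ a * b * (e + x * e)
    lem₁ = Ring.solve-∀ ℚ-ring

  -- With d = D + 2 this is (d/(d-1))^((d-1)p) ≤ e^p, the source of e^p in κ.
  suc^-*≤expPartial : ∀ D p → ℕtoℚ (suc (suc D) ℕ.^ (suc D ℕ.* p)) ≤
    ℕtoℚ (suc D ℕ.^ (suc D ℕ.* p)) * expPartial (ℕtoℚ p) (suc D ℕ.* p)
  suc^-*≤expPartial D p = subst (λ y → ℕtoℚ (suc (suc D) ℕ.^ r) ≤ ℕtoℚ (suc D ℕ.^ r) * expPartial y r) eq (suc^≤expPartial D r)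
    where
    r = suc D ℕ.* p
    eq : ℕtoℚ r * 1/suc D ≡ ℕtoℚ p
    eq = trans (cong (_* 1/suc D) (ℕtoℚ-* (suc D) p)) (trans (lem (ℕtoℚ (suc D)) (ℕtoℚ p) (1/suc D))
           (trans (cong (_* ℕtoℚ p) (1/suc-inverse D)) (*-identityˡ (ℕtoℚ p))))
      where
      lem : ∀ a p x → a * p * x ≡ a * x * p
      lem = Ring.solve-∀ ℚ-ring

  -- With ε = α/Γ, each step multiplies g by at most 1 - ε ≤ e^(-ε).
  exp-decay : ∀ (g : ℕ → ℕ) α Γ n → (∀ m → m ℕ.< n → Γ ℕ.* g (suc m) ℕ.+ α ℕ.* g m ℕ.≤ Γ ℕ.* g m) → 1 ℕ.≤ Γ →
    ∀ q → 0ℚ ≤ q → q * ℕtoℚ Γ ≤ ℕtoℚ n * ℕtoℚ α →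
    ∀ m → expPartial q m * ℕtoℚ (g n) ≤ ℕtoℚ (g 0)
  exp-decay g α (suc Γ₁) n step 1≤Γ q 0≤q q≤ M =
    ≤-trans (*-monoˡ (0≤ℕtoℚ (g n)) (expPartial-mono M 0≤q q≤nε)) (decay n ℕ.≤-refl)
    where
    Γ = ℕtoℚ (suc Γ₁)
    ε = ℕtoℚ α * 1/suc Γ₁
    Γ-pos : Positive Γ
    Γ-pos = ℕtoℚ-pos 1≤Γ
    0≤ε : 0ℚ ≤ ε
    0≤ε = 0≤* (0≤ℕtoℚ α) (0≤1/suc Γ₁)
    Γε : Γ * ε ≡ ℕtoℚ α
    Γε = trans (lem Γ (ℕtoℚ α) (1/suc Γ₁)) (trans (cong (_* ℕtoℚ α) (1/suc-inverse Γ₁)) (*-identityˡ _))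
      where
      lem : ∀ a p x → a * (p * x) ≡ a * x * p
      lem = Ring.solve-∀ ℚ-ring
    q≤nε : q ≤ ℕtoℚ n * ε
    q≤nε = *-cancelʳ-≤-pos Γ {{Γ-pos}} (≤-trans q≤ (≤-reflexive (trans (cong (ℕtoℚ n *_) (sym Γε)) (lem (ℕtoℚ n) Γ ε))))
      where
      lem : ∀ n a x → n * (a * x) ≡ n * x * a
      lem = Ring.solve-∀ ℚ-ring
    decay : ∀ m → m ℕ.≤ n → expPartial (ℕtoℚ m * ε) M * ℕtoℚ (g m) ≤ ℕtoℚ (g 0)
    decay zero    _   = ≤-reflexive (trans (cong (λ z → expPartial z M * ℕtoℚ (g 0)) (*-zeroˡ ε))
      (trans (cong (_* ℕtoℚ (g 0)) (expPartial-0 M)) (*-identityˡ _)))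
    -- The chain is e' G' ≤ e' (1 - ε) G ≤ e G, with `αe'G` added on both sides in place of the
    -- difference.
    decay (suc m) m<n = ≤-trans (*-cancelˡ-≤-pos Γ {{Γ-pos}} (+-cancel (begin
      Γ * (e' * G') + αe'G                ≡⟨ lem₁ Γ e' G' (ℕtoℚ α) G ⟩
      e' * (Γ * G' + ℕtoℚ α * G)          ≤⟨ *-monoʳ 0≤e' step' ⟩
      e' * (Γ * G)                        ≡⟨ lem₂ e' Γ G ⟩
      Γ * G * e'                          ≤⟨ *-monoʳ (0≤* (0≤ℕtoℚ (suc Γ₁)) (0≤ℕtoℚ (g m))) e'≤ ⟩
      Γ * G * (e + ε * e')                ≡⟨ lem₃ Γ G e ε e' ⟩
      Γ * (e * G) + Γ * ε * (e' * G)      ≡⟨ cong (λ z → Γ * (e * G) + z * (e' * G)) Γε ⟩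
      Γ * (e * G) + αe'G                  ∎))) (decay m (ℕ.<⇒≤ m<n))
      where
      open ≤-Reasoning
      y = ℕtoℚ m * ε
      0≤y : 0ℚ ≤ y
      0≤y = 0≤* (0≤ℕtoℚ m) 0≤ε
      e = expPartial y M
      e' = expPartial (ℕtoℚ (suc m) * ε) M
      G = ℕtoℚ (g m)
      G' = ℕtoℚ (g (suc m))
      αe'G = ℕtoℚ α * (e' * G)
      0≤e' : 0ℚ ≤ e'
      0≤e' = 0≤expPartial M (0≤* (0≤ℕtoℚ (suc m)) 0≤ε)
      e'≤ : e' ≤ e + ε * e'
      e'≤ = subst (λ z → expPartial z M ≤ e + ε * expPartial z M) eq (expPartial-+-≤ 0≤ε 0≤y M)
        where
        lem : ∀ m x → m * x + x ≡ (1ℚ + m) * x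
        lem = Ring.solve-∀ ℚ-ring
        eq : y + ε ≡ ℕtoℚ (suc m) * ε
        eq = trans (lem (ℕtoℚ m) ε) (cong (_* ε) (sym (ℕtoℚ-+ 1 m)))
      step' : Γ * G' + ℕtoℚ α * G ≤ Γ * G
      step' = subst₂ _≤_ (trans (ℕtoℚ-+ (suc Γ₁ ℕ.* g (suc m)) (α ℕ.* g m)) (cong₂ _+_ (ℕtoℚ-* (suc Γ₁) (g (suc m))) (ℕtoℚ-* α (g m))))
        (ℕtoℚ-* (suc Γ₁) (g m)) (ℕtoℚ-mono (step m m<n))
      +-cancel : ∀ {p q r} → p + r ≤ q + r → p ≤ q
      +-cancel {p} {q} {r} le = subst₂ _≤_ (lem p r) (lem q r) (+-monoˡ-≤ (- r) le)
        where
        lem : ∀ p r → p + r + - r ≡ p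
        lem p r = trans (+-assoc p r (- r)) (trans (cong (p +_) (+-inverseʳ r)) (+-identityʳ p))
      lem₁ : ∀ c e h a k → c * (e * h) + a * (e * k) ≡ e * (c * h + a * k)
      lem₁ = Ring.solve-∀ ℚ-ring
      lem₂ : ∀ e c k → e * (c * k) ≡ c * k * e
      lem₂ = Ring.solve-∀ ℚ-ring
      lem₃ : ∀ c k e x f → c * k * (e + x * f) ≡ c * (e * k) + c * x * (f * k)
      lem₃ = Ring.solve-∀ ℚ-ring

open import Data.Nat using (ℕ; zero; suc; _+_; _*_; _∸_; _^_; _/_; _≤_; _<_; z≤n; s≤s; NonZero; >-nonZero; >-nonZero⁻¹)
open import Data.Nat.Properties
open import Data.Nat.DivMod using (m/n*n≤m; m≡m%n+[m/n]*n; m%n<n)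
open import Data.Nat.Tactic.RingSolver using (solve-∀)
open import Data.Bool using (Bool; true; false)
open import Data.Fin using (Fin; zero; suc; fromℕ)
open import Data.List using (List; []; _∷_; [_]; length; _++_; map; take; drop; replicate; upTo; cartesianProduct)
open import Data.List.Properties
open import Data.List.Membership.Propositional using (_∈_)
open import Data.List.Membership.Propositional.Properties
open import Data.List.Relation.Unary.Any using (Any; here; there)
import Data.List.Relation.Unary.Any.Properties as Any
open import Data.List.Relation.Unary.All using (All; []; _∷_)
import Data.List.Relation.Unary.All as All
import Data.List.Relation.Unary.All.Properties as All
open import Data.List.Relation.Unary.AllPairs using ([]; _∷_)
open import Data.List.Relation.Unary.Unique.Propositional using (Unique)
import Data.List.Relation.Unary.Unique.Propositional.Properties as Unique
open import Data.Vec using (Vec; []; _∷_; toList; lookup)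
import Data.Vec as Vec
import Data.Vec.Properties as Vec
open import Data.Product using (∃; _×_; _,_; proj₁; proj₂)
open import Data.Sum using (_⊎_; inj₁; inj₂)
open import Data.Unit using (tt)
open import Function using (_∘_)
open import Function.Bundles using (_⇔_; Equivalence)
open import Relation.Nullary using (¬_; contradiction)
open import Relation.Binary.PropositionalEquality hiding ([_])
import Data.Rational as Q
import Data.Rational.Properties as Q
import Tactic.RingSolver as Ring
open Exponential

-- Coefficient sequences of words

-- A sequence stands for its generating function Σ gⱼ zʲ, where z counts the
-- letters true of a word.
Seq : Set
Seq = ℕ → ℕ

δ : Seq
δ zero    = 1
δ (suc _) = 0

shift : Seq → Seq
shift g zero    = 0
shift g (suc j) = g j

shifts : ℕ → Seq → Seq
shifts zero    g = g
shifts (suc i) g = shift (shifts i g)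

-- Multiplication by 1 + z: one free letter.
E : Seq → Seq
E g j = g j + shift g j

E^ : ℕ → Seq → Seq
E^ zero    g = g
E^ (suc f) g = E (E^ f g)

-- The derivation (1 + z) d/dz, for which 1 + z is an eigenvector.
D : Seq → Seq
D g j = suc j * g (suc j) + j * g j

trues : List Bool → ℕ
trues []           = 0
trues (true  ∷ xs) = suc (trues xs)
trues (false ∷ xs) = trues xs

-- Multiplication by (1 + z)^|xs| - z^(trues xs): one block different from xs.
Y : List Bool → Seq → Seq
Y []           g j = 0
Y (true  ∷ xs) g j = shift (Y xs g) j + E^ (length xs) g j
Y (false ∷ xs) g j = Y xs g j + shift (E^ (length xs) g) j

infix 4 _≦_
_≦_ : Seq → Seq → Set
g ≦ h = ∀ j → g j ≤ h j

_⊕_ : Seq → Seq → Seq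
(g ⊕ h) j = g j + h j

_⊙_ : ℕ → Seq → Seq
(c ⊙ g) j = c * g j

infixl 6 _⊕_
infixr 7 _⊙_

shift-mono : ∀ {g h} → g ≦ h → shift g ≦ shift h
shift-mono le zero    = z≤n
shift-mono le (suc j) = le j

shift-cong : ∀ {g h} → g ≗ h → shift g ≗ shift h
shift-cong eq zero    = refl
shift-cong eq (suc j) = eq j

shift-⊕ : ∀ g h → shift (g ⊕ h) ≗ shift g ⊕ shift h
shift-⊕ g h zero    = refl
shift-⊕ g h (suc j) = refl

shift-⊙ : ∀ c g → shift (c ⊙ g) ≗ c ⊙ shift g
shift-⊙ c g zero    = sym (*-zeroʳ c)
shift-⊙ c g (suc j) = refl

E-mono : ∀ {g h} → g ≦ h → E g ≦ E h
E-mono le j = +-mono-≤ (le j) (shift-mono le j)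

E-cong : ∀ {g h} → g ≗ h → E g ≗ E h
E-cong eq j = cong₂ _+_ (eq j) (shift-cong eq j)

swap₄ : ∀ a b c d → (a + b) + (c + d) ≡ (a + c) + (b + d)
swap₄ = solve-∀

E-⊕ : ∀ g h → E (g ⊕ h) ≗ E g ⊕ E h
E-⊕ g h j = trans (cong (g j + h j +_) (shift-⊕ g h j)) (swap₄ (g j) (h j) _ _)

E-⊙ : ∀ c g → E (c ⊙ g) ≗ c ⊙ E g
E-⊙ c g j = trans (cong (c * g j +_) (shift-⊙ c g j)) (sym (*-distribˡ-+ c (g j) _))

E^-mono : ∀ f {g h} → g ≦ h → E^ f g ≦ E^ f h
E^-mono zero    le = le
E^-mono (suc f) le = E-mono (E^-mono f le)

E^-cong : ∀ f {g h} → g ≗ h → E^ f g ≗ E^ f h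
E^-cong zero    eq = eq
E^-cong (suc f) eq = E-cong (E^-cong f eq)

E^-⊕ : ∀ f g h → E^ f (g ⊕ h) ≗ E^ f g ⊕ E^ f h
E^-⊕ zero    g h j = refl
E^-⊕ (suc f) g h j = trans (E-cong (E^-⊕ f g h) j) (E-⊕ (E^ f g) (E^ f h) j)

E^-⊙ : ∀ f c g → E^ f (c ⊙ g) ≗ c ⊙ E^ f g
E^-⊙ zero    c g j = refl
E^-⊙ (suc f) c g j = trans (E-cong (E^-⊙ f c g) j) (E-⊙ c (E^ f g) j)

E^-+ : ∀ f f' g → E^ (f + f') g ≡ E^ f (E^ f' g)
E^-+ zero    f' g = refl
E^-+ (suc f) f' g = cong E (E^-+ f f' g)

E-shift : ∀ g → E (shift g) ≗ shift (E g)
E-shift g zero    = refl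
E-shift g (suc j) = refl

E^-shift : ∀ f g → E^ f (shift g) ≗ shift (E^ f g)
E^-shift zero    g j = refl
E^-shift (suc f) g j = trans (E-cong (E^-shift f g) j) (E-shift (E^ f g) j)

E^-shifts : ∀ f i g → E^ f (shifts i g) ≗ shifts i (E^ f g)
E^-shifts f zero    g j = refl
E^-shifts f (suc i) g j = trans (E^-shift f (shifts i g) j) (shift-cong (E^-shifts f i g) j)

shifts-+ : ∀ i g j → shifts i g (i + j) ≡ g j
shifts-+ zero    g j = refl
shifts-+ (suc i) g j = shifts-+ i g j

D-⊕ : ∀ g h → D (g ⊕ h) ≗ D g ⊕ D h
D-⊕ g h j = lem (suc j) j (g (suc j)) (h (suc j)) (g j) (h j)
  where
  lem : ∀ a b x y u v → a * (x + y) + b * (u + v) ≡ (a * x + b * u) + (a * y + b * v)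
  lem = solve-∀

D-cong : ∀ {g h} → g ≗ h → D g ≗ D h
D-cong eq j = cong₂ _+_ (cong (suc j *_) (eq (suc j))) (cong (j *_) (eq j))

D-shift : ∀ g → D (shift g) ≗ shift (D g) ⊕ (g ⊕ shift g)
D-shift g zero    = lem (g 0)
  where
  lem : ∀ x → 1 * x + 0 ≡ 0 + (x + 0)
  lem = solve-∀
D-shift g (suc j) = lem j (g (suc j)) (g j)
  where
  lem : ∀ j x y → suc (suc j) * x + suc j * y ≡ (suc j * x + j * y) + (x + y)
  lem = solve-∀

D-E : ∀ g → D (E g) ≗ E (D g) ⊕ E g
D-E g j = begin
  D (g ⊕ shift g) j                              ≡⟨ D-⊕ g (shift g) j ⟩
  D g j + D (shift g) j                          ≡⟨ cong (D g j +_) (D-shift g j) ⟩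
  D g j + (shift (D g) j + (g j + shift g j))    ≡⟨ sym (+-assoc (D g j) _ _) ⟩
  D g j + shift (D g) j + (g j + shift g j)      ∎
  where open ≡-Reasoning

D-E^ : ∀ f g → D (E^ f g) ≗ E^ f (D g) ⊕ f ⊙ E^ f g
D-E^ zero    g j = sym (+-identityʳ _)
D-E^ (suc f) g j = begin
  D (E (E^ f g)) j                                   ≡⟨ D-E (E^ f g) j ⟩
  E (D (E^ f g)) j + E (E^ f g) j                    ≡⟨ cong (_+ E (E^ f g) j) (E-cong (D-E^ f g) j) ⟩
  E (E^ f (D g) ⊕ f ⊙ E^ f g) j + E (E^ f g) j       ≡⟨ cong (_+ E (E^ f g) j) (E-⊕ (E^ f (D g)) _ j) ⟩
  E (E^ f (D g)) j + E (f ⊙ E^ f g) j + E (E^ f g) j ≡⟨ cong (λ t → E (E^ f (D g)) j + t + E (E^ f g) j) (E-⊙ f (E^ f g) j) ⟩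
  E (E^ f (D g)) j + f * E (E^ f g) j + E (E^ f g) j ≡⟨ lem (E (E^ f (D g)) j) f (E (E^ f g) j) ⟩
  E (E^ f (D g)) j + suc f * E (E^ f g) j            ∎
  where
  open ≡-Reasoning
  lem : ∀ x f y → x + f * y + y ≡ x + suc f * y
  lem = solve-∀

D-shifts : ∀ i g → D (shifts (suc i) g) ≗ shifts (suc i) (D g) ⊕ suc i ⊙ (shifts i g ⊕ shifts (suc i) g)
D-shifts zero    g j = trans (D-shift g j) (cong (shift (D g) j +_) (sym (+-identityʳ _)))
D-shifts (suc i) g j = begin
  D (shift h) j                                            ≡⟨ D-shift h j ⟩
  shift (D h) j + (h j + shift h j)                        ≡⟨ cong (_+ (h j + shift h j)) (shift-cong (D-shifts i g) j) ⟩
  shift (shifts (suc i) (D g) ⊕ suc i ⊙ (shifts i g ⊕ h)) j + (h j + shift h j)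
    ≡⟨ cong (_+ (h j + shift h j)) (trans (shift-⊕ (shifts (suc i) (D g)) _ j)
         (cong (u +_) (trans (shift-⊙ (suc i) (shifts i g ⊕ h) j) (cong (suc i *_) (shift-⊕ (shifts i g) h j))))) ⟩
  u + suc i * (h j + shift h j) + (h j + shift h j)        ≡⟨ lem u (suc i) (h j + shift h j) ⟩
  u + suc (suc i) * (h j + shift h j)                      ∎
  where
  open ≡-Reasoning
  h = shifts (suc i) g
  u = shifts (suc (suc i)) (D g) j
  lem : ∀ x f y → x + f * y + y ≡ x + suc f * y
  lem = solve-∀

Y-mono : ∀ xs {g h} → g ≦ h → Y xs g ≦ Y xs h
Y-mono []           le j = z≤n
Y-mono (true  ∷ xs) le j = +-mono-≤ (shift-mono (Y-mono xs le) j) (E^-mono (length xs) le j)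
Y-mono (false ∷ xs) le j = +-mono-≤ (Y-mono xs le j) (shift-mono (E^-mono (length xs) le) j)

-- A block of free letters either differs from `xs` or equals it. This stands in for subtraction:
-- identities for `Y` follow from those for `E^` by cancelling the shift.
Y-E^ : ∀ xs g → Y xs g ⊕ shifts (trues xs) g ≗ E^ (length xs) g
Y-E^ []           g j = refl
Y-E^ (true  ∷ xs) g j = begin
  shift (Y xs g) j + e + shift (shifts (trues xs) g) j   ≡⟨ lem (shift (Y xs g) j) e _ ⟩
  e + (shift (Y xs g) j + shift (shifts (trues xs) g) j) ≡⟨ cong (e +_) (sym (shift-⊕ (Y xs g) _ j)) ⟩
  e + shift (Y xs g ⊕ shifts (trues xs) g) j             ≡⟨ cong (e +_) (shift-cong (Y-E^ xs g) j) ⟩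
  e + shift (E^ (length xs) g) j                         ∎
  where
  open ≡-Reasoning
  e = E^ (length xs) g j
  lem : ∀ a b c → a + b + c ≡ b + (a + c)
  lem = solve-∀
Y-E^ (false ∷ xs) g j = begin
  Y xs g j + e + shifts (trues xs) g j   ≡⟨ lem (Y xs g j) e _ ⟩
  Y xs g j + shifts (trues xs) g j + e   ≡⟨ cong (_+ e) (Y-E^ xs g j) ⟩
  E^ (length xs) g j + e                 ∎
  where
  open ≡-Reasoning
  e = shift (E^ (length xs) g) j
  lem : ∀ a b c → a + b + c ≡ a + c + b
  lem = solve-∀

shifts-⊕ : ∀ i g h → shifts i (g ⊕ h) ≗ shifts i g ⊕ shifts i h
shifts-⊕ zero    g h j = refl
shifts-⊕ (suc i) g h j = trans (shift-cong (shifts-⊕ i g h) j) (shift-⊕ (shifts i g) _ j)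

shifts-⊙ : ∀ i c g → shifts i (c ⊙ g) ≗ c ⊙ shifts i g
shifts-⊙ zero    c g j = refl
shifts-⊙ (suc i) c g j = trans (shift-cong (shifts-⊙ i c g) j) (shift-⊙ c (shifts i g) j)

Y-⊕ : ∀ xs g h → Y xs (g ⊕ h) ≗ Y xs g ⊕ Y xs h
Y-⊕ xs g h j = +-cancelʳ-≡ (shifts t (g ⊕ h) j) _ _ (begin
  Y xs (g ⊕ h) j + shifts t (g ⊕ h) j                       ≡⟨ Y-E^ xs (g ⊕ h) j ⟩
  E^ (length xs) (g ⊕ h) j                                  ≡⟨ E^-⊕ (length xs) g h j ⟩
  E^ (length xs) g j + E^ (length xs) h j                   ≡⟨ cong₂ _+_ (sym (Y-E^ xs g j)) (sym (Y-E^ xs h j)) ⟩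
  (Y xs g j + shifts t g j) + (Y xs h j + shifts t h j)     ≡⟨ swap₄ (Y xs g j) _ _ _ ⟩
  (Y xs g j + Y xs h j) + (shifts t g j + shifts t h j)     ≡⟨ cong (Y xs g j + Y xs h j +_) (sym (shifts-⊕ t g h j)) ⟩
  (Y xs g j + Y xs h j) + shifts t (g ⊕ h) j                ∎)
  where
  open ≡-Reasoning
  t = trues xs

Y-⊙ : ∀ xs c g → Y xs (c ⊙ g) ≗ c ⊙ Y xs g
Y-⊙ xs c g j = +-cancelʳ-≡ (shifts t (c ⊙ g) j) _ _ (begin
  Y xs (c ⊙ g) j + shifts t (c ⊙ g) j    ≡⟨ Y-E^ xs (c ⊙ g) j ⟩
  E^ (length xs) (c ⊙ g) j               ≡⟨ E^-⊙ (length xs) c g j ⟩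
  c * E^ (length xs) g j                 ≡⟨ cong (c *_) (sym (Y-E^ xs g j)) ⟩
  c * (Y xs g j + shifts t g j)          ≡⟨ *-distribˡ-+ c (Y xs g j) _ ⟩
  c * Y xs g j + c * shifts t g j        ≡⟨ cong (c * Y xs g j +_) (sym (shifts-⊙ t c g j)) ⟩
  c * Y xs g j + shifts t (c ⊙ g) j      ∎)
  where
  open ≡-Reasoning
  t = trues xs

-- The product rule for the polynomial Y = (1 + z)^ℓ - z^(i+1): (1 + z) Y' = ℓ (1 + z)^ℓ - (i+1)(z^i
-- + z^(i+1)), where (1 + z)^ℓ is written back as Y + z^(i+1) and the negative term is moved to the
-- left.
D-Y : ∀ xs {i} → trues xs ≡ suc i → ∀ g →
      D (Y xs g) ⊕ suc i ⊙ (shifts i g ⊕ shifts (suc i) g) ≗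
      Y xs (D g) ⊕ length xs ⊙ (Y xs g ⊕ shifts (suc i) g)
D-Y xs {i} eq g j = +-cancelʳ-≡ u _ _ (begin
  D (Y xs g) j + w + u                  ≡⟨ lem₁ (D (Y xs g) j) w u ⟩
  D (Y xs g) j + (u + w)                ≡⟨ cong (D (Y xs g) j +_) (sym (D-shifts i g j)) ⟩
  D (Y xs g) j + D (shifts (suc i) g) j ≡⟨ sym (D-⊕ (Y xs g) (shifts (suc i) g) j) ⟩
  D (Y xs g ⊕ shifts (suc i) g) j       ≡⟨ D-cong (dec g) j ⟩
  D (E^ ℓ g) j                          ≡⟨ D-E^ ℓ g j ⟩
  E^ ℓ (D g) j + ℓ * E^ ℓ g j           ≡⟨ cong₂ (λ s t → s + ℓ * t) (sym (dec (D g) j)) (sym (dec g j)) ⟩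
  Y xs (D g) j + u + v                  ≡⟨ lem₂ (Y xs (D g) j) u v ⟩
  Y xs (D g) j + v + u                  ∎)
  where
  open ≡-Reasoning
  ℓ = length xs
  u = shifts (suc i) (D g) j
  v = ℓ * (Y xs g j + shifts (suc i) g j)
  w = suc i * (shifts i g j + shifts (suc i) g j)
  dec : ∀ h → Y xs h ⊕ shifts (suc i) h ≗ E^ ℓ h
  dec h j = subst (λ t → Y xs h j + shifts t h j ≡ E^ ℓ h j) eq (Y-E^ xs h j)
  lem₁ : ∀ a b c → a + b + c ≡ a + (c + b)
  lem₁ = solve-∀
  lem₂ : ∀ a b c → a + b + c ≡ a + c + b
  lem₂ = solve-∀

-- Binomial coefficients as coefficients of powers of 1 + z

binom : ℕ → Seq
binom n = E^ n δ

D-δ : D δ ≗ 0 ⊙ δ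
D-δ zero    = refl
D-δ (suc j) = cong₂ _+_ (*-zeroʳ (suc (suc j))) (*-zeroʳ (suc j))

binom-absorb : ∀ n j → suc j * binom n (suc j) + j * binom n j ≡ n * binom n j
binom-absorb n j = trans (D-E^ n δ j) (cong (_+ n * binom n j) (trans (E^-cong n D-δ j) (E^-⊙ n 0 δ j)))

binom-zero : ∀ n → binom n 0 ≡ 1
binom-zero zero    = refl
binom-zero (suc n) = trans (+-identityʳ _) (binom-zero n)

binom-pos : ∀ {n i} → i ≤ n → 1 ≤ binom n i
binom-pos {n} z≤n = ≤-reflexive (sym (binom-zero n))
binom-pos {suc n} {suc i} (s≤s i≤n) = ≤-trans (binom-pos i≤n) (m≤n+m _ (binom n (suc i)))

binom≥n : ∀ {n i} → suc i < n → n ≤ binom n (suc i)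
binom≥n {suc n} {i} (s≤s 1+i≤n) with m≤n⇒m<n∨m≡n 1+i≤n
... | inj₁ 1+i<n = ≤-trans (≤-reflexive (+-comm 1 n))
                     (+-mono-≤ (binom≥n 1+i<n) (binom-pos (<⇒≤ (<⇒≤ 1+i<n))))
binom≥n {i = zero}  _ | inj₂ refl = ≤-refl
binom≥n {i = suc i} _ | inj₂ refl = +-mono-≤ (binom-pos {suc (suc i)} ≤-refl) (binom≥n ≤-refl)

-- Two neighbouring terms of the binomial expansion of (1 + z)^ℓ are kept. For i = p - 1 they absorb
-- the disturbance caused by a forbidden block.
E^-≥ : ∀ ℓ i g → binom ℓ i ⊙ shifts i g ⊕ binom ℓ (suc i) ⊙ shifts (suc i) g ≦ E^ ℓ g
E^-≥ zero    zero    g j = ≤-reflexive (trans (+-identityʳ _) (+-identityʳ _))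
E^-≥ zero    (suc i) g j = z≤n
E^-≥ (suc ℓ) zero    g j = begin
  (binom ℓ 0 + 0) * g j + (binom ℓ 1 + binom ℓ 0) * shift g j
    ≡⟨ lem (binom ℓ 0) (binom ℓ 1) (g j) (shift g j) ⟩
  (binom ℓ 0 * g j + binom ℓ 1 * shift g j) + binom ℓ 0 * shift g j
    ≤⟨ +-mono-≤ (E^-≥ ℓ 0 g j) (≤-trans (≤-reflexive (sym (shift-⊙ (binom ℓ 0) g j)))
         (shift-mono (λ i → ≤-trans (m≤m+n _ _) (E^-≥ ℓ 0 g i)) j)) ⟩
  E^ ℓ g j + shift (E^ ℓ g) j ∎
  where
  open ≤-Reasoning
  lem : ∀ a b x y → (a + 0) * x + (b + a) * y ≡ (a * x + b * y) + a * y
  lem = solve-∀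
E^-≥ (suc ℓ) (suc i) g j = begin
  (binom ℓ (suc i) + binom ℓ i) * x + (binom ℓ (suc (suc i)) + binom ℓ (suc i)) * y
    ≡⟨ lem (binom ℓ (suc i)) (binom ℓ i) (binom ℓ (suc (suc i))) x y ⟩
  (binom ℓ (suc i) * x + binom ℓ (suc (suc i)) * y) + (binom ℓ i * x + binom ℓ (suc i) * y)
    ≤⟨ +-mono-≤ (E^-≥ ℓ (suc i) g j) (≤-trans (≤-reflexive (sym (trans (shift-⊕ (binom ℓ i ⊙ shifts i g) _ j)
         (cong₂ _+_ (shift-⊙ (binom ℓ i) _ j) (shift-⊙ (binom ℓ (suc i)) _ j))))) (shift-mono (E^-≥ ℓ i g) j)) ⟩
  E^ ℓ g j + shift (E^ ℓ g) j ∎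
  where
  open ≤-Reasoning
  x = shifts (suc i) g j
  y = shifts (suc (suc i)) g j
  lem : ∀ b a c x y → (b + a) * x + (c + b) * y ≡ (b * x + c * y) + (a * x + b * y)
  lem = solve-∀

-- Ratios of consecutive coefficients

-- Up d M n g says (1 + z) g' ≤ (M + n/d) g coefficientwise, Low that
-- (1 + z) g' ≥ (M - n/d) g; for g = (1 + z)^M both hold with n = 0.
Up Low : ℕ → ℕ → ℕ → Seq → Set
Up  d M n g = d ⊙ D g ≦ (d * M + n) ⊙ g
Low d M n g = (d * M) ⊙ g ≦ d ⊙ D g ⊕ n ⊙ g

-- As D((1 + z) g) = (1 + z) D g + (1 + z) g, a free letter raises M by 1 and leaves the error n as
-- it is.
Up-E : ∀ d M n g → Up d M n g → Up d (suc M) n (E g)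
Up-E d M n g up j = begin
  d * D (E g) j                     ≡⟨ cong (d *_) (D-E g j) ⟩
  d * (E (D g) j + E g j)           ≡⟨ *-distribˡ-+ d _ _ ⟩
  d * E (D g) j + d * E g j         ≡⟨ cong (_+ d * E g j) (sym (E-⊙ d (D g) j)) ⟩
  E (d ⊙ D g) j + d * E g j         ≤⟨ +-monoˡ-≤ _ (E-mono up j) ⟩
  E ((d * M + n) ⊙ g) j + d * E g j ≡⟨ cong (_+ d * E g j) (E-⊙ (d * M + n) g j) ⟩
  (d * M + n) * E g j + d * E g j   ≡⟨ lem d M n (E g j) ⟩
  (d * suc M + n) * E g j           ∎
  where
  open ≤-Reasoning
  lem : ∀ d M n x → (d * M + n) * x + d * x ≡ (d * suc M + n) * x
  lem = solve-∀

Low-E : ∀ d M n g → Low d M n g → Low d (suc M) n (E g)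
Low-E d M n g low j = begin
  d * suc M * E g j                        ≡⟨ lem₁ d M (E g j) ⟩
  d * M * E g j + d * E g j                ≡⟨ cong (_+ d * E g j) (sym (E-⊙ (d * M) g j)) ⟩
  E ((d * M) ⊙ g) j + d * E g j            ≤⟨ +-monoˡ-≤ _ (E-mono low j) ⟩
  E (d ⊙ D g ⊕ n ⊙ g) j + d * E g j        ≡⟨ cong (_+ d * E g j) (trans (E-⊕ (d ⊙ D g) (n ⊙ g) j)
                                                (cong₂ _+_ (E-⊙ d (D g) j) (E-⊙ n g j))) ⟩
  d * E (D g) j + n * E g j + d * E g j    ≡⟨ lem₂ d n (E (D g) j) (E g j) ⟩
  d * (E (D g) j + E g j) + n * E g j      ≡⟨ cong (λ t → d * t + n * E g j) (sym (D-E g j)) ⟩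
  d * D (E g) j + n * E g j                ∎
  where
  open ≤-Reasoning
  lem₁ : ∀ d M x → d * suc M * x ≡ d * M * x + d * x
  lem₁ = solve-∀
  lem₂ : ∀ d n u x → d * u + n * x + d * x ≡ d * (u + x) + n * x
  lem₂ = solve-∀

Up-E^ : ∀ d M n f g → Up d M n g → Up d (f + M) n (E^ f g)
Up-E^ d M n zero    g up = up
Up-E^ d M n (suc f) g up = Up-E d (f + M) n (E^ f g) (Up-E^ d M n f g up)

Low-E^ : ∀ d M n f g → Low d M n g → Low d (f + M) n (E^ f g)
Low-E^ d M n zero    g low = low
Low-E^ d M n (suc f) g low = Low-E d (f + M) n (E^ f g) (Low-E^ d M n f g low)

Up-δ : ∀ d → Up d 0 0 δ
Up-δ d j = ≤-trans (≤-reflexive (trans (cong (d *_) (D-δ j)) (*-zeroʳ d))) z≤n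

Low-δ : ∀ d → Low d 0 0 δ
Low-δ d j = ≤-trans (≤-reflexive (cong (_* δ j) (*-zeroʳ d))) z≤n

module Block (d₁ p₀ : ℕ) (xs : List Bool)
             (trues-xs : trues xs ≡ suc (suc p₀))
             (length-xs : length xs ≡ suc (suc d₁) * suc (suc p₀)) where

  d p e ℓ : ℕ
  d = suc (suc d₁)
  p = suc (suc p₀)
  e = suc d₁ * p
  ℓ = d * p

  p-1<ℓ : suc p₀ < ℓ
  p-1<ℓ = ≤-trans ≤-refl (m≤m+n p e)

  -- Absorption gives p binom(ℓ, p) = (e + 1) binom(ℓ, p-1), and binom(ℓ, p-1) ≥ ℓ = dp because p -
  -- 1 ≥ 1. The summand 1 pays for the removed z^p in `Y≥₁`.
  binom-ℓ-p : suc (d * e) ≤ binom ℓ p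
  binom-ℓ-p = ≤-trans (≤-trans (s≤s (m≤n+m (d * e) (suc d₁))) (≤-reflexive (lem d e)))
    (*-cancelˡ-≤ p (begin
      p * (d * suc e)                            ≡⟨ lem₁ p d e ⟩
      suc e * ℓ                                  ≤⟨ *-monoʳ-≤ (suc e) (binom≥n p-1<ℓ) ⟩
      suc e * b                                  ≡⟨ +-cancelʳ-≡ (suc p₀ * b) _ _ (trans (lem₂ e p₀ b)
                                                      (sym (binom-absorb ℓ (suc p₀)))) ⟩
      p * binom ℓ p                              ∎))
    where
    open ≤-Reasoning
    b = binom ℓ (suc p₀)
    lem : ∀ d e → d + d * e ≡ d * suc e
    lem = solve-∀
    lem₁ : ∀ p d e → p * (d * suc e) ≡ suc e * (d * p)
    lem₁ = solve-∀
    lem₂ : ∀ e p₀ b → suc e * b + suc p₀ * b ≡ (suc (suc p₀) + e) * b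
    lem₂ = solve-∀

  Y+shifts : ∀ g → Y xs g ⊕ shifts p g ≗ E^ ℓ g
  Y+shifts g j = subst₂ (λ s t → Y xs g j + shifts s g j ≡ E^ t g j) trues-xs length-xs (Y-E^ xs g j)

  Y≥₁ : ∀ g → (d * e) ⊙ shifts p g ≦ Y xs g
  Y≥₁ g j = +-cancelʳ-≤ s _ _ (begin
    d * e * s + s                                        ≡⟨ +-comm (d * e * s) s ⟩
    suc (d * e) * s                                      ≤⟨ *-monoˡ-≤ s binom-ℓ-p ⟩
    binom ℓ p * s                                        ≤⟨ m≤n+m _ _ ⟩
    binom ℓ (suc p₀) * shifts (suc p₀) g j + binom ℓ p * s ≤⟨ E^-≥ ℓ (suc p₀) g j ⟩
    E^ ℓ g j                                             ≡⟨ sym (Y+shifts g j) ⟩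
    Y xs g j + s                                         ∎)
    where
    open ≤-Reasoning
    s = shifts p g j

  Y≥₂ : ∀ g → ℓ ⊙ shifts (suc p₀) g ≦ Y xs g
  Y≥₂ g j = +-cancelʳ-≤ s _ _ (begin
    ℓ * t + s                               ≤⟨ +-mono-≤ (*-monoˡ-≤ t (binom≥n p-1<ℓ))
                                                 (≤-trans (≤-reflexive (sym (*-identityˡ s)))
                                                   (*-monoˡ-≤ s (binom-pos {ℓ} {p} (m≤m+n p e)))) ⟩
    binom ℓ (suc p₀) * t + binom ℓ p * s    ≤⟨ E^-≥ ℓ (suc p₀) g j ⟩
    E^ ℓ g j                                ≡⟨ sym (Y+shifts g j) ⟩
    Y xs g j + s                            ∎)
    where
    open ≤-Reasoning
    s = shifts p g j
    t = shifts (suc p₀) g j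

  -- The terms with p z^p in `D-Y` cancel. What remains disturbs the rate ℓ by e z^p upwards and p
  -- z^(p-1) downwards; `Y≥₁` and `Y≥₂` bound each by 1/d of the block polynomial, so a block raises
  -- n by 1 in `Up-Y` and `Low-Y`.
  D-Y' : ∀ g → D (Y xs g) ⊕ p ⊙ shifts (suc p₀) g ≗ Y xs (D g) ⊕ ℓ ⊙ Y xs g ⊕ e ⊙ shifts p g
  D-Y' g j = +-cancelʳ-≡ (p * s) _ _ (begin
    D (Y xs g) j + p * t + p * s              ≡⟨ lem₁ (D (Y xs g) j) p t s ⟩
    D (Y xs g) j + p * (t + s)                ≡⟨ D-Y xs trues-xs g j ⟩
    Y xs (D g) j + length xs * (Y xs g j + s) ≡⟨ cong (λ l → Y xs (D g) j + l * (Y xs g j + s)) length-xs ⟩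
    Y xs (D g) j + (p + e) * (Y xs g j + s)   ≡⟨ lem₂ (Y xs (D g) j) p e (Y xs g j) s ⟩
    Y xs (D g) j + (p + e) * Y xs g j + e * s + p * s ∎)
    where
    open ≡-Reasoning
    s = shifts p g j
    t = shifts (suc p₀) g j
    lem₁ : ∀ x p t s → x + p * t + p * s ≡ x + p * (t + s)
    lem₁ = solve-∀
    lem₂ : ∀ x p e y s → x + (p + e) * (y + s) ≡ x + (p + e) * y + e * s + p * s
    lem₂ = solve-∀

  Up-Y : ∀ M n g → Up d M n g → Up d (ℓ + M) (suc n) (Y xs g)
  Up-Y M n g up j = begin
    d * D (Y xs g) j                                  ≤⟨ m≤m+n _ _ ⟩
    d * D (Y xs g) j + d * (p * t)                    ≡⟨ sym (*-distribˡ-+ d (D (Y xs g) j) (p * t)) ⟩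
    d * (D (Y xs g) j + p * t)                        ≡⟨ cong (d *_) (D-Y' g j) ⟩
    d * (Y xs (D g) j + ℓ * y + e * s)                ≡⟨ lem₁ d (Y xs (D g) j) ℓ y e s ⟩
    d * Y xs (D g) j + (d * ℓ * y + d * e * s)        ≤⟨ +-mono-≤ Yup (+-monoʳ-≤ (d * ℓ * y) (Y≥₁ g j)) ⟩
    (d * M + n) * y + (d * ℓ * y + y)                 ≡⟨ lem₂ d M n ℓ y ⟩
    (d * (ℓ + M) + suc n) * y                         ∎
    where
    open ≤-Reasoning
    s = shifts p g j
    t = shifts (suc p₀) g j
    y = Y xs g j
    Yup : d * Y xs (D g) j ≤ (d * M + n) * y
    Yup = subst₂ _≤_ (Y-⊙ xs d (D g) j) (Y-⊙ xs (d * M + n) g j) (Y-mono xs up j)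
    lem₁ : ∀ d x l y e s → d * (x + l * y + e * s) ≡ d * x + (d * l * y + d * e * s)
    lem₁ = solve-∀
    lem₂ : ∀ d M n l y → (d * M + n) * y + (d * l * y + y) ≡ (d * (l + M) + suc n) * y
    lem₂ = solve-∀

  Low-Y : ∀ M n g → Low d M n g → Low d (ℓ + M) (suc n) (Y xs g)
  Low-Y M n g low j = begin
    d * (ℓ + M) * y                                      ≡⟨ lem₁ d ℓ M y ⟩
    d * M * y + d * (ℓ * y)                              ≤⟨ +-monoˡ-≤ (d * (ℓ * y)) Ylow ⟩
    d * Y xs (D g) j + n * y + d * (ℓ * y)               ≤⟨ m≤m+n _ (d * (e * s)) ⟩
    d * Y xs (D g) j + n * y + d * (ℓ * y) + d * (e * s) ≡⟨ lem₂ d (Y xs (D g) j) (n * y) (ℓ * y) (e * s) ⟩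
    d * (Y xs (D g) j + ℓ * y + e * s) + n * y           ≡⟨ cong (λ x → d * x + n * y) (sym (D-Y' g j)) ⟩
    d * (D (Y xs g) j + p * t) + n * y                   ≡⟨ lem₃ d (D (Y xs g) j) p t (n * y) ⟩
    d * D (Y xs g) j + (d * p * t + n * y)               ≤⟨ +-monoʳ-≤ (d * D (Y xs g) j) (+-monoˡ-≤ (n * y) (Y≥₂ g j)) ⟩
    d * D (Y xs g) j + suc n * y                         ∎
    where
    open ≤-Reasoning
    s = shifts p g j
    t = shifts (suc p₀) g j
    y = Y xs g j
    Ylow : d * M * y ≤ d * Y xs (D g) j + n * y
    Ylow = subst₂ _≤_ (Y-⊙ xs (d * M) g j)
      (trans (Y-⊕ xs (d ⊙ D g) (n ⊙ g) j) (cong₂ _+_ (Y-⊙ xs d (D g) j) (Y-⊙ xs n g j)))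
      (Y-mono xs low j)
    lem₁ : ∀ d l M y → d * (l + M) * y ≡ d * M * y + d * (l * y)
    lem₁ = solve-∀
    lem₂ : ∀ d x u v w → d * x + u + d * v + d * w ≡ d * (x + v + w) + u
    lem₂ = solve-∀
    lem₃ : ∀ d x p t u → d * (x + p * t) + u ≡ d * x + (d * p * t + u)
    lem₃ = solve-∀

  Y^ : ℕ → Seq → Seq
  Y^ zero    g = g
  Y^ (suc m) g = Y xs (Y^ m g)

  Up-Y^ : ∀ m → Up d (m * ℓ) m (Y^ m δ)
  Up-Y^ zero    = Up-δ d
  Up-Y^ (suc m) = Up-Y (m * ℓ) m (Y^ m δ) (Up-Y^ m)

  Low-Y^ : ∀ m → Low d (m * ℓ) m (Y^ m δ)
  Low-Y^ zero    = Low-δ d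
  Low-Y^ (suc m) = Low-Y (m * ℓ) m (Y^ m δ) (Low-Y^ m)

  -- Words of f free letters followed by m blocks.
  Z : ℕ → ℕ → Seq
  Z m f = E^ f (Y^ m δ)

  Up-Z : ∀ m f → Up d (f + m * ℓ) m (Z m f)
  Up-Z m f = Up-E^ d (m * ℓ) m f (Y^ m δ) (Up-Y^ m)

  Low-Z : ∀ m f → Low d (f + m * ℓ) m (Z m f)
  Low-Z m f = Low-E^ d (m * ℓ) m f (Y^ m δ) (Low-Y^ m)

  -- In ℓ free letters next to the m blocks, the pattern either does not stand or stands there and
  -- takes p letters `true`.
  Z-suc : ∀ m f j → Z (suc m) f (p + j) + Z m f j ≡ Z m (f + ℓ) (p + j)
  Z-suc m f j = begin
    E^ f (Y xs g) (p + j) + E^ f g j                       ≡⟨ cong (E^ f (Y xs g) (p + j) +_) (sym (shifts-+ p (E^ f g) j)) ⟩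
    E^ f (Y xs g) (p + j) + shifts p (E^ f g) (p + j)      ≡⟨ cong (E^ f (Y xs g) (p + j) +_) (sym (E^-shifts f p g (p + j))) ⟩
    E^ f (Y xs g) (p + j) + E^ f (shifts p g) (p + j)      ≡⟨ sym (E^-⊕ f (Y xs g) (shifts p g) (p + j)) ⟩
    E^ f (Y xs g ⊕ shifts p g) (p + j)                     ≡⟨ E^-cong f (Y+shifts g) (p + j) ⟩
    E^ f (E^ ℓ g) (p + j)                                  ≡⟨ cong (λ h → h (p + j)) (sym (E^-+ f ℓ g)) ⟩
    E^ (f + ℓ) g (p + j)                                   ∎
    where
    open ≡-Reasoning
    g = Y^ m δ

  -- a = d²p - 1, b = d(d-1)p - 1, A = d²p + 1
  b a A : ℕ
  b = suc (p₀ + d₁ * p + suc d₁ * e)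
  a = b + ℓ
  A = suc (d * ℓ)

  suc-a : suc a ≡ d * ℓ
  suc-a = lem d₁ p₀
    where
    lem : ∀ d₁ p₀ → suc (suc (p₀ + d₁ * suc (suc p₀) + suc d₁ * (suc d₁ * suc (suc p₀))) + suc (suc d₁) * suc (suc p₀))
          ≡ suc (suc d₁) * (suc (suc d₁) * suc (suc p₀))
    lem = solve-∀

  -- For the coefficients x, x' at j, j+1 and M letters, `Up` gives (j+1)(x' + x) ≤ (M + 1 + m/d) x.
  -- With M + 1 ≤ d(j+1) and m ≤ j/p the factor is at most (j+1)(d + 1/(dp)) = (j+1) A/ℓ.
  one-step : ∀ m f j → m * p ≤ j → suc (f + m * ℓ) ≤ d * suc j → ℓ * Z m (suc f) (suc j) ≤ A * Z m f j
  one-step m f j mp≤j M≤ = *-cancelˡ-≤ (suc j) (begin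
    suc j * (d * p * (x' + x))                        ≡⟨ lem₁ j d p x' x ⟩
    p * (d * (suc j * x' + j * x) + d * x)            ≤⟨ *-monoʳ-≤ p (+-monoˡ-≤ (d * x) (Up-Z m f j)) ⟩
    p * ((d * M + m) * x + d * x)                     ≡⟨ lem₂ p d M m x ⟩
    (p * d * suc M + m * p) * x                       ≤⟨ *-monoˡ-≤ x (+-mono-≤ (*-monoʳ-≤ (p * d) M≤) (≤-trans mp≤j (n≤1+n j))) ⟩
    (p * d * (d * suc j) + suc j) * x                 ≡⟨ lem₃ p d j x ⟩
    suc j * (A * x)                                   ∎)
    where
    open ≤-Reasoning
    M = f + m * ℓ
    x = Z m f j
    x' = Z m f (suc j)
    lem₁ : ∀ j d p x' x → suc j * (d * p * (x' + x)) ≡ p * (d * (suc j * x' + j * x) + d * x)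
    lem₁ = solve-∀
    lem₂ : ∀ p d M m x → p * ((d * M + m) * x + d * x) ≡ (p * d * suc M + m * p) * x
    lem₂ = solve-∀
    lem₃ : ∀ p d j x → (p * d * (d * suc j) + suc j) * x ≡ suc j * (suc (d * (d * p)) * x)
    lem₃ = solve-∀

  -- For the coefficients x, x' at i, i+1, `Low` gives x'/x ≥ (M - i - m/d)/(i+1) ≥ d - 1 - 1/(dp) =
  -- b/ℓ, hence (x' + x)/x' ≤ 1 + ℓ/b = a/b.
  zero-step : ∀ m f j → m * p ≤ j → d * j ≤ suc (f + m * ℓ) → b * Z m (suc f) j ≤ a * Z m f j
  zero-step m f zero    _    _  = *-mono-≤ (m≤m+n b ℓ) (≤-reflexive (+-identityʳ _))
  zero-step m f (suc i) mp≤j dj≤ = begin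
    b * (x' + x)      ≡⟨ *-distribˡ-+ b x' x ⟩
    b * x' + b * x    ≤⟨ +-monoʳ-≤ (b * x') bx≤ ⟩
    b * x' + ℓ * x'   ≡⟨ sym (*-distribʳ-+ x' b ℓ) ⟩
    a * x'            ∎
    where
    open ≤-Reasoning
    M = f + m * ℓ
    x = Z m f i
    x' = Z m f (suc i)
    -- This is (i+1) b ≤ ℓ (M - i - m/d); adding pd on both sides brings in M + 1, for which `dj≤`
    -- is stated.
    coeff : suc i * b + (p * (d * i) + p * m) ≤ p * (d * M)
    coeff = +-cancelʳ-≤ (p * d) _ _ (begin
      suc i * b + (p * (d * i) + p * m) + p * d     ≤⟨ +-monoˡ-≤ (p * d) (+-monoʳ-≤ (suc i * b) (+-monoʳ-≤ (p * (d * i))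
                                                         (≤-trans (≤-reflexive (*-comm p m)) mp≤j))) ⟩
      suc i * b + (p * (d * i) + suc i) + p * d     ≡⟨ lem₁ i b p d ⟩
      suc i * suc (b + d * p)                       ≡⟨ cong (suc i *_) suc-a ⟩
      suc i * (d * (d * p))                         ≡⟨ lem₂ i d p ⟩
      p * d * (d * suc i)                           ≤⟨ *-monoʳ-≤ (p * d) dj≤ ⟩
      p * d * suc M                                 ≡⟨ lem₃ p d M ⟩
      p * (d * M) + p * d                           ∎)
      where
      lem₁ : ∀ i b p d → suc i * b + (p * (d * i) + suc i) + p * d ≡ suc i * suc (b + d * p)
      lem₁ = solve-∀
      lem₂ : ∀ i d p → suc i * (d * (d * p)) ≡ p * d * (d * suc i)
      lem₂ = solve-∀
      lem₃ : ∀ p d M → p * d * suc M ≡ p * (d * M) + p * d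
      lem₃ = solve-∀
    bx≤ : b * x ≤ ℓ * x'
    bx≤ = *-cancelˡ-≤ (suc i) (+-cancelʳ-≤ ((p * (d * i) + p * m) * x) _ _ (begin
      suc i * (b * x) + (p * (d * i) + p * m) * x        ≡⟨ lem₁ (suc i) b x (p * (d * i) + p * m) ⟩
      (suc i * b + (p * (d * i) + p * m)) * x            ≤⟨ *-monoˡ-≤ x coeff ⟩
      p * (d * M) * x                                    ≡⟨ *-assoc p (d * M) x ⟩
      p * (d * M * x)                                    ≤⟨ *-monoʳ-≤ p (Low-Z m f i) ⟩
      p * (d * (suc i * x' + i * x) + m * x)             ≡⟨ lem₂ p d i x' x m ⟩
      suc i * (d * p * x') + (p * (d * i) + p * m) * x   ∎))
      where
      lem₁ : ∀ s b x c → s * (b * x) + c * x ≡ (s * b + c) * x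
      lem₁ = solve-∀
      lem₂ : ∀ p d i x' x m → p * (d * (suc i * x' + i * x) + m * x) ≡ suc i * (d * p * x') + (p * (d * i) + p * m) * x
      lem₂ = solve-∀

  zero-steps : ∀ m f j s → m * p ≤ j → d * j ≤ suc (f + m * ℓ) → b ^ s * Z m (s + f) j ≤ a ^ s * Z m f j
  zero-steps m f j zero    _    _   = ≤-refl
  zero-steps m f j (suc s) mp≤j dj≤ = begin
    b * b ^ s * Z m (suc (s + f)) j       ≡⟨ lem b (b ^ s) _ ⟩
    b ^ s * (b * Z m (suc (s + f)) j)     ≤⟨ *-monoʳ-≤ (b ^ s) (zero-step m (s + f) j mp≤j
                                               (≤-trans dj≤ (s≤s (+-monoˡ-≤ (m * ℓ) (m≤n+m f s))))) ⟩
    b ^ s * (a * Z m (s + f) j)           ≡⟨ lem' (b ^ s) a _ ⟩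
    a * (b ^ s * Z m (s + f) j)           ≤⟨ *-monoʳ-≤ a (zero-steps m f j s mp≤j dj≤) ⟩
    a * (a ^ s * Z m f j)                 ≡⟨ sym (*-assoc a (a ^ s) _) ⟩
    a * a ^ s * Z m f j                   ∎
    where
    open ≤-Reasoning
    lem : ∀ x y z → x * y * z ≡ y * (x * z)
    lem = solve-∀
    lem' : ∀ x y z → x * (y * z) ≡ y * (x * z)
    lem' = solve-∀

  α Γ : ℕ
  α = ℓ * b ^ suc d₁
  Γ = A * a ^ suc d₁

  -- The letters are removed in the order false, true, false^(d-2): this keeps
  -- every intermediate step within the range of zero-step and one-step.
  period : ∀ m f j → m * p ≤ j → f + m * ℓ ≡ suc (d * j) → α * Z m (d + f) (suc j) ≤ Γ * Z m f j
  period m f j mp≤j eq = begin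
    ℓ * (b * b ^ d₁) * Z m (d + f) (suc j)               ≡⟨ lem₁ ℓ b (b ^ d₁) (Z m (suc (suc f')) (suc j)) ⟩
    b ^ d₁ * (ℓ * (b * Z m (suc (suc f')) (suc j)))      ≤⟨ *-monoʳ-≤ (b ^ d₁) (*-monoʳ-≤ ℓ (zero-step m (suc f') (suc j)
                                                              (≤-trans mp≤j (n≤1+n j)) (≤-trans (≤-reflexive (sym M≡)) (n≤1+n _)))) ⟩
    b ^ d₁ * (ℓ * (a * Z m (suc f') (suc j)))            ≡⟨ lem₂ (b ^ d₁) ℓ a (Z m (suc f') (suc j)) ⟩
    a * (b ^ d₁ * (ℓ * Z m (suc f') (suc j)))            ≤⟨ *-monoʳ-≤ a (*-monoʳ-≤ (b ^ d₁) (one-step m f' j mp≤j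
                                                              (≤-reflexive M≡))) ⟩
    a * (b ^ d₁ * (A * Z m f' j))                        ≡⟨ lem₂ a (b ^ d₁) A (Z m f' j) ⟩
    A * (a * (b ^ d₁ * Z m f' j))                        ≤⟨ *-monoʳ-≤ A (*-monoʳ-≤ a (zero-steps m f j d₁ mp≤j
                                                              (≤-trans (n≤1+n _) (≤-trans (≤-reflexive (sym eq)) (n≤1+n _))))) ⟩
    A * (a * (a ^ d₁ * Z m f j))                         ≡⟨ lem₃ A a (a ^ d₁) (Z m f j) ⟩
    A * (a * a ^ d₁) * Z m f j                           ∎
    where
    open ≤-Reasoning
    f' = d₁ + f
    M≡ : suc (f' + m * ℓ) ≡ d * suc j
    M≡ = trans (cong suc (trans (+-assoc d₁ f _) (cong (d₁ +_) eq))) (lem d₁ j)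
      where
      lem : ∀ d₁ j → suc (d₁ + suc (suc (suc d₁) * j)) ≡ suc (suc d₁) * suc j
      lem = solve-∀
    lem₁ : ∀ l b c z → l * (b * c) * z ≡ c * (l * (b * z))
    lem₁ = solve-∀
    lem₂ : ∀ c l a z → c * (l * (a * z)) ≡ a * (c * (l * z))
    lem₂ = solve-∀
    lem₃ : ∀ l a c z → l * (a * (c * z)) ≡ l * (a * c) * z
    lem₃ = solve-∀

  -- A period of d letters, one of them `true`, preserves the relation that the length is d times
  -- the number of letters `true` plus 1, so `period` applies again.
  periods : ∀ m f j i → m * p ≤ j → f + m * ℓ ≡ suc (d * j) → α ^ i * Z m (d * i + f) (i + j) ≤ Γ ^ i * Z m f j
  periods m f j zero    _    _  = ≤-reflexive (cong (λ s → 1 * Z m (s + f) j) (*-zeroʳ d))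
  periods m f j (suc i) mp≤j eq = begin
    α * α ^ i * Z m (d * suc i + f) (suc (i + j))     ≡⟨ cong (λ s → α * α ^ i * Z m s (suc (i + j))) (lem d i f) ⟩
    α * α ^ i * Z m (d + (d * i + f)) (suc (i + j))   ≡⟨ lem₁ α (α ^ i) _ ⟩
    α ^ i * (α * Z m (d + (d * i + f)) (suc (i + j))) ≤⟨ *-monoʳ-≤ (α ^ i) (period m (d * i + f) (i + j)
                                                           (≤-trans mp≤j (m≤n+m j i)) eq') ⟩
    α ^ i * (Γ * Z m (d * i + f) (i + j))             ≡⟨ lem₂ (α ^ i) Γ _ ⟩
    Γ * (α ^ i * Z m (d * i + f) (i + j))             ≤⟨ *-monoʳ-≤ Γ (periods m f j i mp≤j eq) ⟩
    Γ * (Γ ^ i * Z m f j)                             ≡⟨ sym (*-assoc Γ (Γ ^ i) _) ⟩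
    Γ * Γ ^ i * Z m f j                               ∎
    where
    open ≤-Reasoning
    eq' : d * i + f + m * ℓ ≡ suc (d * (i + j))
    eq' = trans (+-assoc (d * i) f _) (trans (cong (d * i +_) eq) (lem' d i j))
      where
      lem' : ∀ d i j → d * i + suc (d * j) ≡ suc (d * (i + j))
      lem' = solve-∀
    lem : ∀ d i f → d * suc i + f ≡ d + (d * i + f)
    lem = solve-∀
    lem₁ : ∀ x y z → x * y * z ≡ y * (x * z)
    lem₁ = solve-∀
    lem₂ : ∀ x y z → x * (y * z) ≡ y * (x * z)
    lem₂ = solve-∀

  -- Forbidding the pattern in one more block loses exactly `Z m f j` words. Removing p periods
  -- shows that this is at least the fraction (α/Γ)^p of all.
  Z-decay : ∀ m j → m * p ≤ j →
    let f = suc (d * (j ∸ m * p)) in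
    Γ ^ p * Z (suc m) f (p + j) + α ^ p * Z m (f + ℓ) (p + j) ≤ Γ ^ p * Z m (f + ℓ) (p + j)
  Z-decay m j mp≤j = begin
    Γ ^ p * Z (suc m) f (p + j) + α ^ p * Z m (f + ℓ) (p + j)
      ≤⟨ +-monoʳ-≤ (Γ ^ p * Z (suc m) f (p + j)) (subst (λ s → α ^ p * Z m s (p + j) ≤ Γ ^ p * Z m f j) (+-comm ℓ f)
           (periods m f j p mp≤j eq)) ⟩
    Γ ^ p * Z (suc m) f (p + j) + Γ ^ p * Z m f j   ≡⟨ sym (*-distribˡ-+ (Γ ^ p) (Z (suc m) f (p + j)) _) ⟩
    Γ ^ p * (Z (suc m) f (p + j) + Z m f j)         ≡⟨ cong (Γ ^ p *_) (Z-suc m f j) ⟩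
    Γ ^ p * Z m (f + ℓ) (p + j)                     ∎
    where
    open ≤-Reasoning
    f = suc (d * (j ∸ m * p))
    eq : f + m * ℓ ≡ suc (d * j)
    eq = trans (lem d (j ∸ m * p) m p) (cong (λ s → suc (d * s)) (m∸n+n≡m mp≤j))
      where
      lem : ∀ d i m p → suc (d * i) + m * (d * p) ≡ suc (d * (i + m * p))
      lem = solve-∀

-- Decay in the number of blocks

-- The companion (1 + 1/y)^r ≤ 1/(1 - r/y) of Bernoulli's inequality, with denominators cleared.
-- Each step uses (y + 1) z ≤ y (z + 1), that is z ≤ y.
bernoulli : ∀ r {y z} → r + z ≡ y → suc y ^ r * z ≤ y ^ r * y
bernoulli zero    refl = ≤-refl
bernoulli (suc r) {y} {z} eq = begin
  suc y * suc y ^ r * z     ≡⟨ lem (suc y) (suc y ^ r) z ⟩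
  suc y ^ r * (z + y * z)   ≤⟨ *-monoʳ-≤ (suc y ^ r) (+-monoˡ-≤ (y * z) (≤-trans (m≤n+m z (suc r)) (≤-reflexive eq))) ⟩
  suc y ^ r * (y + y * z)   ≡⟨ lem₁ (suc y ^ r) y z ⟩
  y * (suc y ^ r * suc z)   ≤⟨ *-monoʳ-≤ y (bernoulli r (trans (+-suc r z) eq)) ⟩
  y * (y ^ r * y)           ≡⟨ sym (*-assoc y (y ^ r) y) ⟩
  y * y ^ r * y             ∎
  where
  open ≤-Reasoning
  lem : ∀ s t z → s * t * z ≡ t * (s * z)
  lem = solve-∀
  lem₁ : ∀ t y z → t * (y + y * z) ≡ y * (t * suc z)
  lem₁ = solve-∀

suc^≤ : ∀ c r y → suc c * r ≤ suc y → c * suc (suc y) ^ r ≤ suc c * suc y ^ r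
suc^≤ c r y le = *-cancelʳ-≤ _ _ (suc y) (begin
  c * suc (suc y) ^ r * suc y          ≡⟨ lem c (suc (suc y) ^ r) (suc y) ⟩
  suc (suc y) ^ r * (c * suc y)        ≤⟨ *-monoʳ-≤ (suc (suc y) ^ r) cy≤ ⟩
  suc (suc y) ^ r * (suc c * z)        ≡⟨ lem₁ (suc (suc y) ^ r) (suc c) z ⟩
  suc c * (suc (suc y) ^ r * z)        ≤⟨ *-monoʳ-≤ (suc c) (bernoulli r r+z) ⟩
  suc c * (suc y ^ r * suc y)          ≡⟨ sym (*-assoc (suc c) (suc y ^ r) (suc y)) ⟩
  suc c * suc y ^ r * suc y            ∎)
  where
  open ≤-Reasoning
  z = suc y ∸ r
  r+z : r + z ≡ suc y
  r+z = m+[n∸m]≡n (≤-trans (m≤m+n r (c * r)) le)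
  lem : ∀ c s y → c * s * y ≡ s * (c * y)
  lem = solve-∀
  lem₁ : ∀ s c z → s * (c * z) ≡ c * (s * z)
  lem₁ = solve-∀
  cy≤ : c * suc y ≤ suc c * z
  cy≤ = begin
    c * suc y        ≡⟨ cong (c *_) (sym r+z) ⟩
    c * (r + z)      ≡⟨ *-distribˡ-+ c r z ⟩
    c * r + c * z    ≤⟨ +-monoˡ-≤ (c * z) (+-cancelˡ-≤ r _ _ (≤-trans le (≤-reflexive (sym r+z)))) ⟩
    z + c * z        ∎

*-^ : ∀ o m n → (m * n) ^ o ≡ m ^ o * n ^ o
*-^ zero    m n = refl
*-^ (suc o) m n = trans (cong (m * n *_) (*-^ o m n)) (lem m n (m ^ o) (n ^ o))
  where
  lem : ∀ m n x y → m * n * (x * y) ≡ m * x * (n * y)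
  lem = solve-∀

module Decay (d₁ p₀ : ℕ) (xs : List Bool)
             (trues-xs : trues xs ≡ suc (suc p₀))
             (length-xs : length xs ≡ suc (suc d₁) * suc (suc p₀)) where
  open Block d₁ p₀ xs trues-xs length-xs

  -- So a/b is d/(d-1), the ratio without forbidden blocks, times the error factor 1 + 1/(db).
  a-b : a * suc d₁ ≡ suc (d * b)
  a-b = lem d₁ p₀
    where
    lem : ∀ d₁ p₀ → let p = suc (suc p₀); d = suc (suc d₁); b = suc (p₀ + d₁ * p + suc d₁ * (suc d₁ * p)) in
          (b + d * p) * suc d₁ ≡ suc (d * b)
    lem = solve-∀

  3*A^p≤ : 3 * A ^ p ≤ 4 * (d * ℓ) ^ p
  3*A^p≤ = suc^≤ 3 p _ (begin
    4 * p       ≤⟨ *-monoˡ-≤ p (*-mono-≤ {2} {d} {2} {d} (s≤s (s≤s z≤n)) (s≤s (s≤s z≤n))) ⟩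
    d * d * p   ≡⟨ *-assoc d d p ⟩
    d * ℓ       ∎)
    where open ≤-Reasoning

  2*[ad]^e≤ : 2 * (a * suc d₁) ^ e ≤ 3 * (d * b) ^ e
  2*[ad]^e≤ = subst (λ s → 2 * s ^ e ≤ 3 * (d * b) ^ e) (sym a-b)
    (suc^≤ 2 e _ (≤-trans (m≤m+n (3 * e) _) (≤-reflexive (lem d₁ p₀))))
    where
    lem : ∀ d₁ p₀ → let p = suc (suc p₀); e = suc d₁ * p; b = suc (p₀ + d₁ * p + suc d₁ * e) in
          3 * e + (p₀ + d₁ * p + 2 * d₁ * e + d₁ * b) ≡ suc (suc d₁) * b
    lem = solve-∀

  -- The p letters `true` contribute d^p with error factor at most 4/3, the e letters `false`
  -- contribute (d/(d-1))^e with error factor at most 3/2. The factor 6 clears both denominators,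
  -- and 4/3 · 3/2 is the 2 in κ.
  Γ^p≤ : Γ ^ p * suc d₁ ^ e ≤ 2 * (α ^ p * d ^ p * d ^ e)
  Γ^p≤ = *-cancelˡ-≤ 6 (begin
    6 * (Γ ^ p * suc d₁ ^ e)                          ≡⟨ cong (λ s → 6 * (s * suc d₁ ^ e)) (prod^ A a) ⟩
    6 * (A ^ p * a ^ e * suc d₁ ^ e)                  ≡⟨ lem (A ^ p) (a ^ e) (suc d₁ ^ e) ⟩
    3 * A ^ p * (2 * (a ^ e * suc d₁ ^ e))            ≡⟨ cong (λ s → 3 * A ^ p * (2 * s)) (sym (*-^ e a (suc d₁))) ⟩
    3 * A ^ p * (2 * (a * suc d₁) ^ e)                ≤⟨ *-mono-≤ 3*A^p≤ 2*[ad]^e≤ ⟩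
    4 * (d * ℓ) ^ p * (3 * (d * b) ^ e)               ≡⟨ cong₂ (λ s t → 4 * s * (3 * t)) (*-^ p d ℓ) (*-^ e d b) ⟩
    4 * (d ^ p * ℓ ^ p) * (3 * (d ^ e * b ^ e))       ≡⟨ lem₁ (d ^ p) (ℓ ^ p) (d ^ e) (b ^ e) ⟩
    6 * (2 * (ℓ ^ p * b ^ e * d ^ p * d ^ e))         ≡⟨ cong (λ s → 6 * (2 * (s * d ^ p * d ^ e))) (sym (prod^ ℓ b)) ⟩
    6 * (2 * (α ^ p * d ^ p * d ^ e))                 ∎)
    where
    open ≤-Reasoning
    prod^ : ∀ x y → (x * y ^ suc d₁) ^ p ≡ x ^ p * y ^ e
    prod^ x y = trans (*-^ p x (y ^ suc d₁)) (cong (x ^ p *_) (^-*-assoc y (suc d₁) p))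
    lem : ∀ x y z → 6 * (x * y * z) ≡ 3 * x * (2 * (y * z))
    lem = solve-∀
    lem₁ : ∀ x y z w → 4 * (x * y) * (3 * (z * w)) ≡ 6 * (2 * (y * w * x * z))
    lem₁ = solve-∀

  1≤Γ^p : 1 ≤ Γ ^ p
  1≤Γ^p = >-nonZero⁻¹ (Γ ^ p) {{m^n≢0 Γ p {{m*n≢0 A (a ^ suc d₁) {{_}} {{m^n≢0 a (suc d₁)}}}}}}

  rate : ∀ k n → k ∸ p ≤ n * p → ∀ q → Q.0ℚ Q.≤ q →
    q Q.* ℕtoℚ (2 * p * d ^ p) Q.* expPartial (ℕtoℚ p) e Q.≤ ℕtoℚ (k ∸ p) →
    q Q.* ℕtoℚ (Γ ^ p) Q.≤ ℕtoℚ n Q.* ℕtoℚ (α ^ p)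
  -- In quotients, q ≤ (k-p) / (2 p d^p S) ≤ n (α/Γ)^p, where the partial sum S of e^p dominates
  -- (d/(d-1))^e. Multiplying by p (d-1)^e clears the denominators.
  rate k n k-p≤np q 0≤q hyp = Q.*-cancelʳ-≤-pos (ℕtoℚ (p * h)) {{ℕtoℚ-pos (>-nonZero⁻¹ (p * h) {{m*n≢0 p h {{_}} {{m^n≢0 (suc d₁) e}}}})}} (begin
    q Q.* ℕtoℚ (Γ ^ p) Q.* ℕtoℚ (p * h)            ≡⟨ Q.*-assoc q (ℕtoℚ (Γ ^ p)) (ℕtoℚ (p * h)) ⟩
    q Q.* (ℕtoℚ (Γ ^ p) Q.* ℕtoℚ (p * h))          ≡⟨ cong (q Q.*_) (sym (ℕtoℚ-* (Γ ^ p) (p * h))) ⟩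
    q Q.* ℕtoℚ (Γ ^ p * (p * h))                   ≤⟨ *-monoʳ 0≤q (ℕtoℚ-mono nat≤) ⟩
    q Q.* ℕtoℚ (2 * p * d ^ p * (α ^ p * d ^ e))   ≡⟨ cong (q Q.*_) (trans (ℕtoℚ-* (2 * p * d ^ p) (α ^ p * d ^ e))
                                                       (cong (ℕtoℚ (2 * p * d ^ p) Q.*_) (ℕtoℚ-* (α ^ p) (d ^ e)))) ⟩
    q Q.* (c Q.* (ℕtoℚ (α ^ p) Q.* ℕtoℚ (d ^ e)))  ≤⟨ *-monoʳ 0≤q (*-monoʳ (0≤ℕtoℚ (2 * p * d ^ p)) (*-monoʳ (0≤ℕtoℚ (α ^ p))
                                                       (suc^-*≤expPartial d₁ p))) ⟩
    q Q.* (c Q.* (ℕtoℚ (α ^ p) Q.* (ℕtoℚ h Q.* x)))  ≡⟨ lem q c (ℕtoℚ (α ^ p)) (ℕtoℚ h) x ⟩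
    q Q.* c Q.* x Q.* (ℕtoℚ (α ^ p) Q.* ℕtoℚ h)      ≤⟨ *-monoˡ (0≤* (0≤ℕtoℚ (α ^ p)) (0≤ℕtoℚ h)) (Q.≤-trans hyp (ℕtoℚ-mono k-p≤np)) ⟩
    ℕtoℚ (n * p) Q.* (ℕtoℚ (α ^ p) Q.* ℕtoℚ h)       ≡⟨ cong (Q._* (ℕtoℚ (α ^ p) Q.* ℕtoℚ h)) (ℕtoℚ-* n p) ⟩
    ℕtoℚ n Q.* ℕtoℚ p Q.* (ℕtoℚ (α ^ p) Q.* ℕtoℚ h)  ≡⟨ lem₁ (ℕtoℚ n) (ℕtoℚ p) (ℕtoℚ (α ^ p)) (ℕtoℚ h) ⟩
    ℕtoℚ n Q.* ℕtoℚ (α ^ p) Q.* (ℕtoℚ p Q.* ℕtoℚ h)  ≡⟨ cong (ℕtoℚ n Q.* ℕtoℚ (α ^ p) Q.*_) (sym (ℕtoℚ-* p h)) ⟩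
    ℕtoℚ n Q.* ℕtoℚ (α ^ p) Q.* ℕtoℚ (p * h)         ∎)
    where
    open Q.≤-Reasoning
    h = suc d₁ ^ e
    c = ℕtoℚ (2 * p * d ^ p)
    x = expPartial (ℕtoℚ p) e
    nat≤ : Γ ^ p * (p * h) ≤ 2 * p * d ^ p * (α ^ p * d ^ e)
    nat≤ = ≤-trans (≤-reflexive (n₁ (Γ ^ p) p h)) (≤-trans (*-monoʳ-≤ p Γ^p≤) (≤-reflexive (n₂ p (α ^ p) (d ^ p) (d ^ e))))
      where
      n₁ : ∀ g p h → g * (p * h) ≡ p * (g * h)
      n₁ = solve-∀
      n₂ : ∀ p a c f → p * (2 * (a * c * f)) ≡ 2 * p * c * (a * f)
      n₂ = solve-∀
    lem : ∀ q c a h x → q Q.* (c Q.* (a Q.* (h Q.* x))) ≡ q Q.* c Q.* x Q.* (a Q.* h)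
    lem = Ring.solve-∀ ℚ-ring
    lem₁ : ∀ n p a h → n Q.* p Q.* (a Q.* h) ≡ n Q.* a Q.* (p Q.* h)
    lem₁ = Ring.solve-∀ ℚ-ring

  blocks : ℕ → ℕ → ℕ
  blocks k m = Z m (suc (d * (k ∸ m * p))) k

  blocks-step : ∀ k m → suc m * p ≤ k → Γ ^ p * blocks k (suc m) + α ^ p * blocks k m ≤ Γ ^ p * blocks k m
  blocks-step k m le = subst₂ (λ s t → Γ ^ p * Z (suc m) (suc (d * s)) k + α ^ p * Z m t k ≤ Γ ^ p * Z m t k)
    (∸-+-assoc k p (m * p)) f≡
    (subst (λ i → Γ ^ p * Z (suc m) f i + α ^ p * Z m (f + ℓ) i ≤ Γ ^ p * Z m (f + ℓ) i) (m+[n∸m]≡n p≤k) (Z-decay m j mp≤j))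
    where
    j = k ∸ p
    f = suc (d * (j ∸ m * p))
    p≤k : p ≤ k
    p≤k = ≤-trans (m≤m+n p (m * p)) le
    mp≤j : m * p ≤ j
    mp≤j = +-cancelˡ-≤ p _ _ (≤-trans le (≤-reflexive (sym (m+[n∸m]≡n p≤k))))
    f≡ : f + ℓ ≡ suc (d * (k ∸ m * p))
    f≡ = cong suc (trans (sym (*-distribˡ-+ d (j ∸ m * p) p)) (cong (d *_)
           (trans (sym (+-∸-comm p mp≤j)) (cong (_∸ m * p) (m∸n+n≡m p≤k)))))

  blocks-decay : ∀ k q → Q.0ℚ Q.≤ q →
    q Q.* ℕtoℚ (2 * p * d ^ p) Q.* expPartial (ℕtoℚ p) e Q.≤ ℕtoℚ (k ∸ p) →
    ∀ m → expPartial q m Q.* ℕtoℚ (blocks k (k / p)) Q.≤ ℕtoℚ (blocks k 0)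
  blocks-decay k q 0≤q hyp = exp-decay (blocks k) (α ^ p) (Γ ^ p) (k / p)
    (λ m m<n → blocks-step k m (≤-trans (*-monoˡ-≤ p m<n) (m/n*n≤m k p)))
    1≤Γ^p q 0≤q (rate k (k / p) k-p≤ q 0≤q hyp)
    where
    -- The letters `true` left over by the division into blocks number at most p; this is where
    -- (k-p)_+ comes from.
    k-p≤ : k ∸ p ≤ k / p * p
    k-p≤ = m≤n+o⇒m∸n≤o k p (≤-trans (≤-reflexive (m≡m%n+[m/n]*n k p)) (+-monoˡ-≤ (k / p * p) (<⇒≤ (m%n<n k p))))

-- Codes of trees

length-≤ : ∀ {A B : Set} (f : A → B) {xs : List A} {ys : List B} → Unique xs → (∀ {x} → x ∈ xs → f x ∈ ys) →
           (∀ {x y} → x ∈ xs → y ∈ xs → f x ≡ f y → x ≡ y) → length xs ≤ length ys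
length-≤ f {[]} _ _ _ = z≤n
length-≤ f {x ∷ xs} (x∉ ∷ uniq) f∈ inj with ∈-∃++ (f∈ (here refl))
... | us , vs , refl = ≤-trans (s≤s (length-≤ f uniq f∈′ (λ a b → inj (there a) (there b))))
                               (≤-reflexive (sym (length-++-sucʳ us (f x) vs)))
  where
  f∈′ : ∀ {z} → z ∈ xs → f z ∈ us ++ vs
  f∈′ {z} z∈ with ∈-++⁻ us (f∈ (there z∈))
  ... | inj₁ ∈us          = ∈-++⁺ˡ ∈us
  ... | inj₂ (here fz≡fx) = contradiction (inj (here refl) (there z∈) (sym fz≡fx)) (All.lookup x∉ z∈)
  ... | inj₂ (there ∈vs)  = ∈-++⁺ʳ us ∈vs

length-cartesianProduct : ∀ {A B : Set} (xs : List A) (ys : List B) →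
                          length (cartesianProduct xs ys) ≡ length xs * length ys
length-cartesianProduct []       ys = refl
length-cartesianProduct (x ∷ xs) ys = trans (length-++ (map (x ,_) ys))
  (cong₂ _+_ (length-map (x ,_) ys) (length-cartesianProduct xs ys))

++-split : ∀ {A : Set} (as : List A) {bs} cs {ds} → as ++ bs ≡ cs ++ ds → length as ≤ length cs →
           ∃ λ es → cs ≡ as ++ es × bs ≡ es ++ ds
++-split []       cs       eq _ = cs , refl , eq
++-split (a ∷ as) (c ∷ cs) eq (s≤s le) with ∷-injective eq
... | refl , eq′ with ++-split as cs eq′ le
... | es , refl , eq″ = es , refl , eq″

Word : Set
Word = List Bool

-- The preorder code: true for an internal vertex, false for a leaf.
mutual
  code : ∀ {d} → Tree d → Word
  code leaf      = false ∷ []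
  code (node ts) = true ∷ codeVec ts

  codeVec : ∀ {d n} → Vec (Tree d) n → Word
  codeVec []       = []
  codeVec (t ∷ ts) = code t ++ codeVec ts

-- Deleting the first letter of a code leaves the code of a forest: a leaf disappears, an internal
-- root gives way to its children. Hence the inductions that read a word letter by letter run over
-- forests.
forest : ∀ {d} → List (Tree d) → Word
forest []       = []
forest (t ∷ Ts) = code t ++ forest Ts

forest-++ : ∀ {d} (Ts Us : List (Tree d)) → forest (Ts ++ Us) ≡ forest Ts ++ forest Us
forest-++ []       Us = refl
forest-++ (t ∷ Ts) Us = trans (cong (code t ++_) (forest-++ Ts Us)) (sym (++-assoc (code t) (forest Ts) (forest Us)))

forest-toList : ∀ {d n} (ts : Vec (Tree d) n) → forest (toList ts) ≡ codeVec ts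
forest-toList []       = refl
forest-toList (t ∷ ts) = cong (code t ++_) (forest-toList ts)

forest-children : ∀ {d n} (ts : Vec (Tree d) n) Ts → forest (toList ts ++ Ts) ≡ codeVec ts ++ forest Ts
forest-children ts Ts = trans (forest-++ (toList ts) Ts) (cong (_++ forest Ts) (forest-toList ts))

forest-[] : ∀ {d} (T : Tree d) → forest [ T ] ≡ code T
forest-[] T = ++-identityʳ (code T)

forest-suffix : ∀ {d} u (Ts : List (Tree d)) {v} → forest Ts ≡ u ++ v → ∃ λ (Us : List (Tree d)) → forest Us ≡ v
forest-suffix []      Ts             eq = Ts , eq
forest-suffix (x ∷ u) (leaf    ∷ Ts) eq = forest-suffix u Ts (∷-injectiveʳ eq)
forest-suffix (x ∷ u) (node ts ∷ Ts) eq =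
  forest-suffix u (toList ts ++ Ts) (trans (forest-children ts Ts) (∷-injectiveʳ eq))

-- Unique decoding, by induction on the common word, since opening a root does not yield a
-- structurally smaller list of trees.
forest-injective : ∀ {d} w {Ts Us : List (Tree d)} → forest Ts ≡ w → forest Us ≡ w → Ts ≡ Us
forest-injective []      {[]}            {[]}            _  _   = refl
forest-injective []      {[]}            {leaf    ∷ _}   _  ()
forest-injective []      {[]}            {node _  ∷ _}   _  ()
forest-injective []      {leaf   ∷ _}                    () _
forest-injective []      {node _ ∷ _}                    () _
forest-injective (_ ∷ w) {leaf    ∷ Ts}  {leaf    ∷ Us}  eq eq′ =
  cong (leaf ∷_) (forest-injective w (∷-injectiveʳ eq) (∷-injectiveʳ eq′))
forest-injective (_ ∷ w) {leaf    ∷ Ts}  {node us ∷ Us}  eq eq′ = contradiction (trans eq (sym eq′)) λ ()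
forest-injective (_ ∷ w) {node ts ∷ Ts}  {leaf    ∷ Us}  eq eq′ = contradiction (trans eq (sym eq′)) λ ()
forest-injective (_ ∷ w) {node ts ∷ Ts}  {node us ∷ Us}  eq eq′ with
  split ts us (forest-injective w (trans (forest-children ts Ts) (∷-injectiveʳ eq))
                                  (trans (forest-children us Us) (∷-injectiveʳ eq′)))
  where
  split : ∀ {A : Set} {n} (xs ys : Vec A n) {as bs} → toList xs ++ as ≡ toList ys ++ bs → xs ≡ ys × as ≡ bs
  split []       []       eq = refl , eq
  split (x ∷ xs) (y ∷ ys) eq with ∷-injective eq
  ... | refl , eq′ with split xs ys eq′
  ... | refl , eq″ = refl , eq″
... | refl , refl = refl

code-injective : ∀ {d} {T U : Tree d} → code T ≡ code U → T ≡ U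
code-injective {T = T} {U} eq = ∷-injectiveˡ (forest-injective (code U) {[ T ]} {[ U ]} (trans (forest-[] T) eq) (forest-[] U))

mutual
  length-code : ∀ {d} (T : Tree d) → length (code T) ≡ suc (d * internal T)
  length-code {d} leaf      = cong suc (sym (*-zeroʳ d))
  length-code {d} (node ts) = cong suc (trans (length-codeVec ts) (sym (*-suc d (internalVec ts))))

  length-codeVec : ∀ {d n} (ts : Vec (Tree d) n) → length (codeVec ts) ≡ n + d * internalVec ts
  length-codeVec {d} []               = sym (*-zeroʳ d)
  length-codeVec {d} {suc n} (t ∷ ts) = trans (length-++ (code t))
    (trans (cong₂ _+_ (length-code t) (length-codeVec ts)) (lem d (internal t) n (internalVec ts)))
    where
    lem : ∀ d i n j → suc (d * i) + (n + d * j) ≡ suc n + d * (i + j)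
    lem = solve-∀

trues-++ : ∀ u v → trues (u ++ v) ≡ trues u + trues v
trues-++ []          v = refl
trues-++ (true  ∷ u) v = cong suc (trues-++ u v)
trues-++ (false ∷ u) v = trues-++ u v

mutual
  trues-code : ∀ {d} (T : Tree d) → trues (code T) ≡ internal T
  trues-code leaf      = refl
  trues-code (node ts) = cong suc (trues-codeVec ts)

  trues-codeVec : ∀ {d n} (ts : Vec (Tree d) n) → trues (codeVec ts) ≡ internalVec ts
  trues-codeVec []       = refl
  trues-codeVec (t ∷ ts) = trans (trues-++ (code t) (codeVec ts)) (cong₂ _+_ (trues-code t) (trues-codeVec ts))

-- Rotations of codes

rotate : ℕ → Word → Word
rotate i w = drop i w ++ take i w

length-rotate : ∀ i w → length (rotate i w) ≡ length w
length-rotate i w = trans (length-++-comm (drop i w) (take i w)) (cong length (take++drop≡id i w))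

trues-rotate : ∀ i w → trues (rotate i w) ≡ trues w
trues-rotate i w = trans (trues-++ (drop i w) (take i w)) (trans (+-comm (trues (drop i w)) _)
  (trans (sym (trues-++ (take i w) (drop i w))) (cong trues (take++drop≡id i w))))

-- If x ++ y and a nontrivial rotation of it are both codes of trees, then x and
-- y, being suffixes of codes, are themselves codes of nonempty forests, so
-- x ++ y would be the code of a forest of at least two trees.
no-rotation : ∀ {d} {T U : Tree d} u v → code T ≡ u ++ v → code U ≡ v ++ u → 0 < length v → u ≡ []
no-rotation {T = T} {U} u v eqT eqU 0<v
  with forest-suffix u [ T ] (trans (forest-[] T) eqT) | forest-suffix v [ U ] (trans (forest-[] U) eqU)
... | Vs , refl | Us , refl with forest-injective (code T) {[ T ]} {Us ++ Vs} (forest-[] T)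
                                   (trans (forest-++ Us Vs) (sym eqT))
no-rotation u v eqT eqU 0<v  | _ ∷ _ , refl | []         , refl | _ = refl
no-rotation u v eqT eqU 0<v  | _ ∷ _ , refl | _ ∷ []     , refl | ()
no-rotation u v eqT eqU 0<v  | _ ∷ _ , refl | _ ∷ _ ∷ _  , refl | ()
no-rotation u v eqT eqU ()   | []    , refl | _          , refl | _

-- Cutting at the shorter part gives y′ = y z and x = z x′. The two codes are then z (x′ y) and (x′
-- y) z, rotations of each other, and `no-rotation` makes z empty.
rotation-unique : ∀ {d} {T T′ : Tree d} x y x′ y′ → code T ≡ x ++ y → code T′ ≡ x′ ++ y′ → y ++ x ≡ y′ ++ x′ →
                  0 < length y → length y ≤ length y′ → x ≡ x′ × y ≡ y′
rotation-unique {T = T} {T′} x y x′ y′ eqT eqT′ eq 0<y le with ++-split y y′ eq le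
... | z , refl , refl with no-rotation {T = T} {T′} z (x′ ++ y)
                             (trans eqT (++-assoc z x′ y))
                             (trans eqT′ (sym (++-assoc x′ y z)))
                             (≤-trans 0<y (≤-trans (m≤n+m (length y) (length x′)) (≤-reflexive (sym (length-++ x′)))))
... | refl = refl , sym (++-identityʳ y)

rotate-injective : ∀ {d} {T T′ : Tree d} {i j} → i < length (code T) → j < length (code T′) →
                   rotate i (code T) ≡ rotate j (code T′) → T ≡ T′ × i ≡ j
rotate-injective {T = T} {T′} {i} {j} i< j< eq = conclude (parts-≡ (≤-total (length (drop i w)) (length (drop j w′))))
  where
  w = code T
  w′ = code T′
  nonempty : ∀ {i} (w : Word) → i < length w → 0 < length (drop i w)
  nonempty {i} w i< = ≤-trans (m<n⇒0<n∸m i<) (≤-reflexive (sym (length-drop i w)))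
  parts-≡ : _ → take i w ≡ take j w′ × drop i w ≡ drop j w′
  parts-≡ (inj₁ le) = rotation-unique {T = T} {T′} (take i w) (drop i w) (take j w′) (drop j w′)
    (sym (take++drop≡id i w)) (sym (take++drop≡id j w′)) eq (nonempty w i<) le
  parts-≡ (inj₂ le) with rotation-unique {T = T′} {T} (take j w′) (drop j w′) (take i w) (drop i w)
    (sym (take++drop≡id j w′)) (sym (take++drop≡id i w)) (sym eq) (nonempty w′ j<) le
  ... | eq₁ , eq₂ = sym eq₁ , sym eq₂
  conclude : take i w ≡ take j w′ × drop i w ≡ drop j w′ → T ≡ T′ × i ≡ j
  conclude (eq₁ , eq₂) =
    code-injective (trans (sym (take++drop≡id i w)) (trans (cong₂ _++_ eq₁ eq₂) (take++drop≡id j w′))) ,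
    trans (sym (length-take≡ w i<)) (trans (cong length eq₁) (length-take≡ w′ j<))
    where
    length-take≡ : ∀ {i} (w : Word) → i < length w → length (take i w) ≡ i
    length-take≡ {i} w i< = trans (length-take i w) (m≤n⇒m⊓n≡m (<⇒≤ i<))

-- The code of the path to a p-th descendant along last children, up to that
-- descendant: all siblings along the path are leaves.
path : ℕ → ℕ → Word
path d₁ zero    = []
path d₁ (suc p) = true ∷ replicate d₁ false ++ path d₁ p

length-path : ∀ d₁ p → length (path d₁ p) ≡ suc d₁ * p
length-path d₁ zero    = sym (*-zeroʳ d₁)
length-path d₁ (suc p) = cong suc (trans (length-++ (replicate d₁ false))
  (trans (cong₂ _+_ (length-replicate d₁) (length-path d₁ p)) (lem d₁ p)))
  where
  lem : ∀ d₁ p → d₁ + suc d₁ * p ≡ p + d₁ * suc p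
  lem = solve-∀

trues-path : ∀ d₁ p → trues (path d₁ p) ≡ p
trues-path d₁ zero    = refl
trues-path d₁ (suc p) = cong suc (trans (trues-++ (replicate d₁ false) (path d₁ p)) (trans (cong (_+ trues (path d₁ p)) (falses d₁)) (trues-path d₁ p)))
  where
  falses : ∀ n → trues (replicate n false) ≡ 0
  falses zero    = refl
  falses (suc n) = falses n

-- Each letter `false` uses up one child as a leaf; after n of them the word continues with the last
-- child.
leaves : ∀ {d} n (ts : Vec (Tree d) (suc n)) Ts {w} → forest (toList ts ++ Ts) ≡ replicate n false ++ w →
         ((j : Fin (suc n)) → j ≢ fromℕ n → lookup ts j ≡ leaf) × forest (lookup ts (fromℕ n) ∷ Ts) ≡ w
leaves zero    (t ∷ [])         Ts eq = (λ { zero j≢ → contradiction refl j≢ }) , eq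
leaves (suc n) (node us ∷ ts)   Ts ()
leaves (suc n) (leaf ∷ ts)      Ts eq with leaves n ts Ts (∷-injectiveʳ eq)
... | lvs , eq′ = (λ { zero j≢ → refl ; (suc j) j≢ → lvs j (j≢ ∘ cong suc) }) , eq′

perfPath : ∀ {d₁} p (t : Tree (suc d₁)) Ts {β} → forest (t ∷ Ts) ≡ path d₁ p ++ β → PerfPath p t
perfPath      zero    t         Ts eq = tt
perfPath      (suc p) leaf      Ts ()
perfPath {d₁} (suc p) (node ts) Ts {β} eq
  with leaves d₁ ts Ts (trans (forest-children ts Ts) (trans (∷-injectiveʳ eq) (++-assoc (replicate d₁ false) (path d₁ p) β)))
... | lvs , eq′ = fromℕ d₁ , lvs , perfPath p (lookup ts (fromℕ d₁)) Ts eq′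

any-toList : ∀ {A : Set} {P : A → Set} {n} (xs : Vec A n) → Any P (toList xs) → ∃ λ i → P (lookup xs i)
any-toList (x ∷ xs) (here px)   = zero , px
any-toList (x ∷ xs) (there any) with any-toList xs any
... | i , pxs = suc i , pxs

-- The letters of α are read off until the factor stands at the start of the first tree; opened
-- roots are recorded by `there`. Stating this for forests allows the factor to be sought in two
-- consecutive copies of a code.
perfect-factor : ∀ {d₁} p α (Ts : List (Tree (suc d₁))) {β} → forest Ts ≡ α ++ path d₁ (suc p) ++ β →
                 Any (Perfect (suc p)) Ts
perfect-factor p []      (t ∷ Ts)       eq = here (t , here , perfPath (suc p) t Ts eq)
perfect-factor p (x ∷ α) (leaf    ∷ Ts) eq = there (perfect-factor p α Ts (∷-injectiveʳ eq))
perfect-factor p (x ∷ α) (node ts ∷ Ts) eq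
  with Any.++⁻ (toList ts) (perfect-factor p α (toList ts ++ Ts) (trans (forest-children ts Ts) (∷-injectiveʳ eq)))
... | inj₂ any = there any
... | inj₁ any with any-toList ts any
... | i , S , sub , pp = here (S , there i sub , pp)

_avoids_ : Word → Word → Set
w avoids xs = ∀ α β → w ≢ α ++ xs ++ β

-- w ++ w contains every rotation of w.
rotate-avoids : ∀ {d₁} p (T : Tree (suc d₁)) i → ¬ Perfect (suc p) T → rotate i (code T) avoids path d₁ (suc p)
rotate-avoids {d₁} p T i ¬perf α β eq with perfect-factor p (x ++ α) (T ∷ T ∷ []) {β ++ y} (begin
    w ++ w ++ []                      ≡⟨ cong (w ++_) (++-identityʳ w) ⟩
    w ++ w                            ≡⟨ cong₂ _++_ (sym (take++drop≡id i w)) (sym (take++drop≡id i w)) ⟩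
    (x ++ y) ++ (x ++ y)              ≡⟨ ++-assoc x y (x ++ y) ⟩
    x ++ (y ++ (x ++ y))              ≡⟨ cong (x ++_) (sym (++-assoc y x y)) ⟩
    x ++ ((y ++ x) ++ y)              ≡⟨ cong (λ s → x ++ (s ++ y)) eq ⟩
    x ++ ((α ++ xs ++ β) ++ y)        ≡⟨ cong (x ++_) (++-assoc α (xs ++ β) y) ⟩
    x ++ (α ++ ((xs ++ β) ++ y))      ≡⟨ cong (λ s → x ++ (α ++ s)) (++-assoc xs β y) ⟩
    x ++ (α ++ (xs ++ (β ++ y)))      ≡⟨ sym (++-assoc x α _) ⟩
    (x ++ α) ++ xs ++ (β ++ y)        ∎)
  where
  open ≡-Reasoning
  w = code T
  x = take i w
  y = drop i w
  xs = path d₁ (suc p)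
... | here perf         = ¬perf perf
... | there (here perf) = ¬perf perf

-- Enumerations of words, indexed by the number of letters true, that mirror the
-- operations on sequences.
Words : Set
Words = ℕ → List Word

shiftʷ : Words → Words
shiftʷ L zero    = []
shiftʷ L (suc j) = L j

Eʷ : Words → Words
Eʷ L j = map (false ∷_) (L j) ++ map (true ∷_) (shiftʷ L j)

E^ʷ : ℕ → Words → Words
E^ʷ zero    L = L
E^ʷ (suc f) L = Eʷ (E^ʷ f L)

Yʷ : Word → Words → Words
Yʷ []           L j = []
Yʷ (true  ∷ xs) L j = map (true ∷_) (shiftʷ (Yʷ xs L) j) ++ map (false ∷_) (E^ʷ (length xs) L j)
Yʷ (false ∷ xs) L j = map (false ∷_) (Yʷ xs L j) ++ map (true ∷_) (shiftʷ (E^ʷ (length xs) L) j)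

δʷ : Words
δʷ zero    = [ [] ]
δʷ (suc j) = []

Counts : Words → Seq → Set
Counts L g = ∀ j → length (L j) ≡ g j

length-map++map : ∀ {A B C : Set} (f : A → C) (h : B → C) xs {ys m n} → length xs ≡ m → length ys ≡ n →
                  length (map f xs ++ map h ys) ≡ m + n
length-map++map f h xs {ys} eq₁ eq₂ = trans (length-++ (map f xs))
  (cong₂ _+_ (trans (length-map f xs) eq₁) (trans (length-map h ys) eq₂))

counts-δ : Counts δʷ δ
counts-δ zero    = refl
counts-δ (suc j) = refl

counts-shift : ∀ {L g} → Counts L g → Counts (shiftʷ L) (shift g)
counts-shift c zero    = refl
counts-shift c (suc j) = c j

counts-E^ : ∀ f {L g} → Counts L g → Counts (E^ʷ f L) (E^ f g)
counts-E^ zero    c   = c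
counts-E^ (suc f) {L} c j = length-map++map _ _ (E^ʷ f L j) (counts-E^ f c j) (counts-shift (counts-E^ f c) j)

counts-Y : ∀ xs {L g} → Counts L g → Counts (Yʷ xs L) (Y xs g)
counts-Y []           c j = refl
counts-Y (true  ∷ xs) {L} c j = length-map++map _ _ (shiftʷ (Yʷ xs L) j) (counts-shift (counts-Y xs c) j) (counts-E^ (length xs) c j)
counts-Y (false ∷ xs) {L} c j = length-map++map _ _ (Yʷ xs L j) (counts-Y xs c j) (counts-shift (counts-E^ (length xs) c) j)

module _ (P : Word → Set) (P-tail : ∀ {x w} → P (x ∷ w) → P w) where

  -- A covering property, enough for upper bounds on the number of words with `P`. Closure of `P`
  -- under tails carries it past free letters and blocks.
  Contains : ℕ → Words → Set
  Contains n L = ∀ w → length w ≡ n → P w → w ∈ L (trues w)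

  contains-E : ∀ {n L} → Contains n L → Contains (suc n) (Eʷ L)
  contains-E {L = L} c (true  ∷ w) eq pw = ∈-++⁺ʳ (map (false ∷_) (L (suc (trues w))))
    (∈-map⁺ (true ∷_) (c w (suc-injective eq) (P-tail pw)))
  contains-E         c (false ∷ w) eq pw = ∈-++⁺ˡ (∈-map⁺ (false ∷_) (c w (suc-injective eq) (P-tail pw)))

  contains-E^ : ∀ f {n L} → Contains n L → Contains (f + n) (E^ʷ f L)
  contains-E^ zero    c = c
  contains-E^ (suc f) c = contains-E (contains-E^ f c)

  -- From the first letter at which w departs from `xs`, the rest of the block is free, as in the
  -- recursion of `Yʷ`.
  contains-Y : ∀ xs {n L} → Contains n L → ∀ w → length w ≡ length xs + n → (∀ β → w ≢ xs ++ β) → P w →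
               w ∈ Yʷ xs L (trues w)
  contains-Y []           c w eq ¬pre pw = contradiction refl (¬pre w)
  contains-Y (true  ∷ xs) c (true ∷ w)  eq ¬pre pw = ∈-++⁺ˡ (∈-map⁺ (true ∷_)
    (contains-Y xs c w (suc-injective eq) (λ β → ¬pre β ∘ cong (true ∷_)) (P-tail pw)))
  contains-Y (true  ∷ xs) {L = L} c (false ∷ w) eq ¬pre pw = ∈-++⁺ʳ (map (true ∷_) (shiftʷ (Yʷ xs L) (trues w)))
    (∈-map⁺ (false ∷_) (contains-E^ (length xs) c w (suc-injective eq) (P-tail pw)))
  contains-Y (false ∷ xs) c (false ∷ w) eq ¬pre pw = ∈-++⁺ˡ (∈-map⁺ (false ∷_)
    (contains-Y xs c w (suc-injective eq) (λ β → ¬pre β ∘ cong (false ∷_)) (P-tail pw)))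
  contains-Y (false ∷ xs) {L = L} c (true ∷ w)  eq ¬pre pw = ∈-++⁺ʳ (map (false ∷_) (Yʷ xs L (suc (trues w))))
    (∈-map⁺ (true ∷_) (contains-E^ (length xs) c w (suc-injective eq) (P-tail pw)))

-- Counting trees

graft : ∀ {d h} → Vec (Tree d) (d + h) → Vec (Tree d) (suc h)
graft {d} ts = node (Vec.take d ts) ∷ Vec.drop d ts

graft-injective : ∀ {d h} {ts us : Vec (Tree d) (d + h)} → graft ts ≡ graft us → ts ≡ us
graft-injective {d} {ts = ts} {us} eq = trans (sym (Vec.take++drop≡id d ts))
  (trans (cong₂ Vec._++_ (node-injective (Vec.∷-injectiveˡ eq)) (Vec.∷-injectiveʳ eq)) (Vec.take++drop≡id d us))
  where
  node-injective : ∀ {ts us : Vec (Tree d) d} → node ts ≡ node us → ts ≡ us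
  node-injective refl = refl

internalVec-++ : ∀ {d m n} (ts : Vec (Tree d) m) (us : Vec (Tree d) n) →
                 internalVec (ts Vec.++ us) ≡ internalVec ts + internalVec us
internalVec-++ []       us = refl
internalVec-++ (t ∷ ts) us = trans (cong (internal t +_) (internalVec-++ ts us))
                                   (sym (+-assoc (internal t) (internalVec ts) (internalVec us)))

internalVec-graft : ∀ {d h} (ts : Vec (Tree d) (d + h)) → internalVec (graft ts) ≡ suc (internalVec ts)
internalVec-graft {d} ts = cong suc (trans (sym (internalVec-++ (Vec.take d ts) (Vec.drop d ts)))
                                           (cong internalVec (Vec.take++drop≡id d ts)))

-- The recursion reads the first letter of the preorder code: a leaf is put in front, or `graft`
-- joins the first d of d + h trees under a new root.
forests : (d h r : ℕ) → List (Vec (Tree d) h)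
forests d zero    zero    = [ [] ]
forests d zero    (suc r) = []
forests d (suc h) zero    = map (leaf ∷_) (forests d h zero)
forests d (suc h) (suc r) = map (leaf ∷_) (forests d h (suc r)) ++ map graft (forests d (d + h) r)

forests-internal : ∀ d h r → All (λ ts → internalVec ts ≡ r) (forests d h r)
forests-internal d zero    zero    = refl ∷ []
forests-internal d zero    (suc r) = []
forests-internal d (suc h) zero    = All.map⁺ (forests-internal d h zero)
forests-internal d (suc h) (suc r) = All.++⁺ (All.map⁺ (forests-internal d h (suc r)))
  (All.map⁺ (All.map (λ {ts} eq → trans (internalVec-graft ts) (cong suc eq)) (forests-internal d (d + h) r)))

forests-unique : ∀ d h r → Unique (forests d h r)
forests-unique d zero    zero    = [] ∷ []
forests-unique d zero    (suc r) = []
forests-unique d (suc h) zero    = Unique.map⁺ Vec.∷-injectiveʳ (forests-unique d h zero)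
forests-unique d (suc h) (suc r) = Unique.++⁺ (Unique.map⁺ Vec.∷-injectiveʳ (forests-unique d h (suc r)))
  (Unique.map⁺ graft-injective (forests-unique d (d + h) r)) disjoint
  where
  disjoint : ∀ {ts} → ¬ (ts ∈ map (leaf ∷_) (forests d h (suc r)) × ts ∈ map graft (forests d (d + h) r))
  disjoint (∈₁ , ∈₂) with ∈-map⁻ (leaf ∷_) ∈₁ | ∈-map⁻ graft ∈₂
  ... | _ , _ , refl | _ , _ , ()

-- Raney's formula.
length-forests : ∀ d₁ h r → let d = suc d₁ in (h + d * r) * length (forests d h r) ≡ h * binom (h + d * r) r
length-forests d₁ zero    zero    = cong (_* 1) (*-zeroʳ d₁)
length-forests d₁ zero    (suc r) = *-zeroʳ (suc d₁ * suc r)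
length-forests d₁ (suc h) zero    = cong₂ _*_ (trans (cong (suc h +_) (*-zeroʳ d₁)) (+-identityʳ (suc h)))
  (trans (one (suc h)) (sym (binom-zero (suc h + suc d₁ * 0))))
  where
  one : ∀ h → length (forests (suc d₁) h zero) ≡ 1
  one zero    = refl
  one (suc h) = trans (length-map (leaf ∷_) (forests (suc d₁) h zero)) (one h)
-- Both recursive lists have codes of n letters, and multiplying by n lets both instances of the
-- formula apply. The summand d r y allows absorption, n y = (r+1) x + r y, to be inserted without
-- subtraction.
length-forests d₁ (suc h) (suc r) = *-cancelˡ-≡ _ _ n {{n≢0}} (+-cancelʳ-≡ (d * r * y) _ _ (begin
  n * (suc n * length (forests d (suc h) (suc r))) + d * r * y
    ≡⟨ cong (λ l → n * (suc n * l) + d * r * y) (length-map++map (leaf ∷_) graft (forests d h (suc r)) {forests d (d + h) r} refl refl) ⟩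
  n * (suc n * (f₁ + f₂)) + d * r * y                     ≡⟨ lem₁ n f₁ f₂ (d * r * y) ⟩
  suc n * (n * f₁ + n * f₂) + d * r * y                   ≡⟨ cong₂ (λ s t → suc n * (s + t) + d * r * y) (length-forests d₁ h (suc r)) ih ⟩
  suc n * (h * x + (d + h) * y) + d * r * y               ≡⟨ lem₂ d h r x y ⟩
  suc n * h * x + d * (n * y) + n * suc h * y             ≡⟨ cong (λ s → suc n * h * x + d * s + n * suc h * y) (sym (binom-absorb n r)) ⟩
  suc n * h * x + d * (suc r * x + r * y) + n * suc h * y ≡⟨ lem₃ d h r x y ⟩
  n * (suc h * (x + y)) + d * r * y                       ∎))
  where
  open ≡-Reasoning
  d = suc d₁
  n = h + d * suc r
  n≢0 : NonZero n
  n≢0 = >-nonZero (≤-trans (s≤s z≤n) (m≤n+m (d * suc r) h))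
  x = binom n (suc r)
  y = binom n r
  f₁ = length (forests d h (suc r))
  f₂ = length (forests d (d + h) r)
  ih : n * f₂ ≡ (d + h) * y
  ih = subst (λ s → s * f₂ ≡ (d + h) * binom s r) (lem d h r) (length-forests d₁ (d + h) r)
    where
    lem : ∀ d h r → d + h + d * r ≡ h + d * suc r
    lem = solve-∀
  lem₁ : ∀ n a b c → n * (suc n * (a + b)) + c ≡ suc n * (n * a + n * b) + c
  lem₁ = solve-∀
  lem₂ : ∀ d h r x y → let n = h + d * suc r in
    suc n * (h * x + (d + h) * y) + d * r * y ≡ suc n * h * x + d * (n * y) + n * suc h * y
  lem₂ = solve-∀
  lem₃ : ∀ d h r x y → let n = h + d * suc r in
    suc n * h * x + d * (suc r * x + r * y) + n * suc h * y ≡ n * (suc h * (x + y)) + d * r * y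
  lem₃ = solve-∀

binom≤trees : ∀ d₁ k (C : List (Tree (suc d₁))) → (∀ T → internal T ≡ k → T ∈ C) →
              binom (suc (suc d₁ * k)) k ≤ suc (suc d₁ * k) * length C
binom≤trees d₁ k C complete = begin
  binom (suc (suc d₁ * k)) k                              ≡⟨ sym (+-identityʳ _) ⟩
  1 * binom (suc (suc d₁ * k)) k                          ≡⟨ sym (length-forests d₁ 1 k) ⟩
  suc (suc d₁ * k) * length (forests (suc d₁) 1 k)        ≤⟨ *-monoʳ-≤ (suc (suc d₁ * k))
                                                               (length-≤ Vec.head (forests-unique (suc d₁) 1 k) head∈ head-injective) ⟩
  suc (suc d₁ * k) * length C                             ∎
  where
  open ≤-Reasoning
  head∈ : ∀ {ts} → ts ∈ forests (suc d₁) 1 k → Vec.head ts ∈ C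
  head∈ {t ∷ []} ts∈ = complete t (trans (sym (+-identityʳ (internal t))) (All.lookup (forests-internal (suc d₁) 1 k) ts∈))
  head-injective : ∀ {ts us} → ts ∈ forests (suc d₁) 1 k → us ∈ forests (suc d₁) 1 k → Vec.head ts ≡ Vec.head us → ts ≡ us
  head-injective {t ∷ []} {u ∷ []} _ _ refl = refl

-- The bound for p at least 2

module Trees (d₁ p₀ : ℕ) where
  d p : ℕ
  d = suc (suc d₁)
  p = suc (suc p₀)

  pat : Word
  pat = path (suc d₁) p

  open Decay d₁ p₀ pat (trues-path (suc d₁) p) (length-path (suc d₁) p)
  open Block d₁ p₀ pat (trues-path (suc d₁) p) (length-path (suc d₁) p) using (ℓ; Z; Y^)

  Y^ʷ : ℕ → Words
  Y^ʷ zero    = δʷ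
  Y^ʷ (suc m) = Yʷ pat (Y^ʷ m)

  counts-Y^ : ∀ m → Counts (Y^ʷ m) (Y^ m δ)
  counts-Y^ zero    = counts-δ
  counts-Y^ (suc m) = counts-Y pat (counts-Y^ m)

  tail-avoids : ∀ {x w} → (x ∷ w) avoids pat → w avoids pat
  tail-avoids {x} av α β eq = av (x ∷ α) β (cong (x ∷_) eq)

  contains-Y^ : ∀ m → Contains (_avoids pat) tail-avoids (m * ℓ) (Y^ʷ m)
  contains-Y^ zero    []      eq av = here refl
  contains-Y^ (suc m) w       eq av = contains-Y (_avoids pat) tail-avoids pat (contains-Y^ m) w
    (trans eq (cong (_+ m * ℓ) (sym (length-path (suc d₁) p)))) (av []) av

  -- The N rotations of each code are distinct over all of `B` and avoid the pattern everywhere, in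
  -- particular at the last n blocks.
  trees≤blocks : ∀ k n → n * p ≤ k → (B : List (Tree d)) → Unique B → (∀ T → T ∈ B → internal T ≡ k × ¬ Perfect p T) →
                 suc (d * k) * length B ≤ blocks k n
  trees≤blocks k n np≤k B uniq B-spec = begin
    N * length B                              ≡⟨ *-comm N (length B) ⟩
    length B * N                              ≡⟨ cong (length B *_) (sym (length-upTo N)) ⟩
    length B * length (upTo N)                ≡⟨ sym (length-cartesianProduct B (upTo N)) ⟩
    length (cartesianProduct B (upTo N))      ≤⟨ length-≤ rot (Unique.cartesianProduct⁺ uniq (Unique.upTo⁺ N)) rot∈ rot-injective ⟩
    length (E^ʷ f (Y^ʷ n) k)                  ≡⟨ counts-E^ f (counts-Y^ n) k ⟩
    blocks k n                                ∎
    where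
    open ≤-Reasoning
    N = suc (d * k)
    f = suc (d * (k ∸ n * p))
    rot : Tree d × ℕ → Word
    rot (T , i) = rotate i (code T)
    length-T : ∀ {T} → T ∈ B → length (code T) ≡ N
    length-T {T} T∈ = trans (length-code T) (cong (λ s → suc (d * s)) (proj₁ (B-spec T T∈)))
    f+nℓ : f + n * ℓ ≡ N
    f+nℓ = trans (lem d (k ∸ n * p) n p) (cong (λ s → suc (d * s)) (m∸n+n≡m np≤k))
      where
      lem : ∀ d i m p → suc (d * i) + m * (d * p) ≡ suc (d * (i + m * p))
      lem = solve-∀
    rot∈ : ∀ {Ti} → Ti ∈ cartesianProduct B (upTo N) → rot Ti ∈ E^ʷ f (Y^ʷ n) k
    rot∈ {T , i} Ti∈ with ∈-cartesianProduct⁻ B (upTo N) Ti∈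
    ... | T∈ , _ = subst (λ j → rotate i (code T) ∈ E^ʷ f (Y^ʷ n) j)
      (trans (trues-rotate i (code T)) (trans (trues-code T) (proj₁ (B-spec T T∈))))
      (contains-E^ (_avoids pat) tail-avoids f (contains-Y^ n) (rotate i (code T))
        (trans (length-rotate i (code T)) (trans (length-T T∈) (sym f+nℓ)))
        (rotate-avoids (suc p₀) T i (proj₂ (B-spec T T∈))))
    rot-injective : ∀ {Ti Uj} → Ti ∈ cartesianProduct B (upTo N) → Uj ∈ cartesianProduct B (upTo N) → rot Ti ≡ rot Uj → Ti ≡ Uj
    rot-injective {T , i} {U , j} Ti∈ Uj∈ eq with ∈-cartesianProduct⁻ B (upTo N) Ti∈ | ∈-cartesianProduct⁻ B (upTo N) Uj∈
    ... | T∈ , i∈ | U∈ , j∈ with rotate-injective {T = T} {U}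
             (subst (i <_) (sym (length-T T∈)) (∈-upTo⁻ i∈)) (subst (j <_) (sym (length-T U∈)) (∈-upTo⁻ j∈)) eq
    ... | refl , refl = refl

  bound : ∀ k → (C : List (Tree d)) → (∀ T → internal T ≡ k → T ∈ C) →
    (B : List (Tree d)) → Unique B → (∀ T → T ∈ B → internal T ≡ k × ¬ Perfect p T) →
    ∀ q → Q.0ℚ Q.≤ q → (∀ n → q Q.* ℕtoℚ (2 * p * d ^ p) Q.* expPartial (ℕtoℚ p) n Q.≤ ℕtoℚ (k ∸ p)) →
    ∀ m → expPartial q m Q.* ℕtoℚ (length B) Q.≤ ℕtoℚ (length C)
  bound k C complete B uniq B-spec q 0≤q hyp m = Q.*-cancelˡ-≤-pos (ℕtoℚ N) {{ℕtoℚ-pos {N} (s≤s z≤n)}} (begin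
    ℕtoℚ N Q.* (x Q.* ℕtoℚ (length B))    ≡⟨ lem (ℕtoℚ N) x (ℕtoℚ (length B)) ⟩
    x Q.* (ℕtoℚ N Q.* ℕtoℚ (length B))    ≡⟨ cong (x Q.*_) (sym (ℕtoℚ-* N (length B))) ⟩
    x Q.* ℕtoℚ (N * length B)             ≤⟨ *-monoʳ (0≤expPartial m 0≤q) (ℕtoℚ-mono (trees≤blocks k (k / p) (m/n*n≤m k p) B uniq B-spec)) ⟩
    x Q.* ℕtoℚ (blocks k (k / p))         ≤⟨ blocks-decay k q 0≤q (hyp (suc d₁ * p)) m ⟩
    ℕtoℚ (blocks k 0)                     ≤⟨ ℕtoℚ-mono (binom≤trees (suc d₁) k C complete) ⟩
    ℕtoℚ (N * length C)                   ≡⟨ ℕtoℚ-* N (length C) ⟩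
    ℕtoℚ N Q.* ℕtoℚ (length C)            ∎)
    where
    open Q.≤-Reasoning
    N = suc (d * k)
    x = expPartial q m
    lem : ∀ n x b → n Q.* (x Q.* b) ≡ x Q.* (n Q.* b)
    lem = Ring.solve-∀ ℚ-ring

mutual
  -- Descending through internal children ends at a vertex with only leaves below it, where every
  -- child gives a path of length 1.
  perfect-1 : ∀ {d₁} (ts : Vec (Tree (suc d₁)) (suc d₁)) → Perfect 1 (node ts)
  perfect-1 ts with perfect-1-children ts
  ... | inj₁ leaf-ts             = node ts , here , zero , (λ j _ → leaf-ts j) , tt
  ... | inj₂ (i , S , sub , pp)  = S , there i sub , pp

  perfect-1-children : ∀ {d₁ n} (ts : Vec (Tree (suc d₁)) n) →
                       (∀ j → lookup ts j ≡ leaf) ⊎ ∃ λ i → Perfect 1 (lookup ts i)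
  perfect-1-children []             = inj₁ λ ()
  perfect-1-children (node us ∷ ts) = inj₂ (zero , perfect-1 us)
  perfect-1-children (leaf ∷ ts) with perfect-1-children ts
  ... | inj₁ leaf-ts    = inj₁ λ { zero → refl ; (suc j) → leaf-ts j }
  ... | inj₂ (i , perf) = inj₂ (suc i , perf)

-- The hypothesis on q, over all partial sums, says 0 ≤ q ≤ κ (k-p)_+, and the conclusion says e^q
-- |B| ≤ |C|. Letting the rational q tend to κ (k-p)_+ gives the real bound; truncated subtraction
-- is the positive part.
theorem1p7 : (d p : ℕ) → 2 ≤ d → 1 ≤ p → (k : ℕ)
    → (C : List (Tree d)) → Unique C → (∀ T → T ∈ C ⇔ internal T ≡ k)
    → (B : List (Tree d)) → Unique B → (∀ T → T ∈ B ⇔ (internal T ≡ k × ¬ Perfect p T))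
    → (q : Q.ℚ) → Q.0ℚ Q.≤ q
    → (∀ n → q Q.* ℕtoℚ (2 * p * d ^ p) Q.* expPartial (ℕtoℚ p) n Q.≤ ℕtoℚ (k ∸ p))
    → ∀ m → expPartial q m Q.* ℕtoℚ (length B) Q.≤ ℕtoℚ (length C)
theorem1p7 (suc (suc d₁)) (suc (suc p₀)) _ _ k C _ C-spec B uniq-B B-spec q 0≤q hyp =
  Trees.bound d₁ p₀ k C (λ T → Equivalence.from (C-spec T)) B uniq-B (λ T → Equivalence.to (B-spec T)) q 0≤q hyp
theorem1p7 (suc (suc d₁)) 1 _ _ zero C _ C-spec B uniq-B B-spec q 0≤q hyp m = begin
  expPartial q m Q.* ℕtoℚ (length B)       ≡⟨ cong (λ x → expPartial x m Q.* ℕtoℚ (length B)) q≡0 ⟩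
  expPartial Q.0ℚ m Q.* ℕtoℚ (length B)    ≡⟨ cong (Q._* ℕtoℚ (length B)) (expPartial-0 m) ⟩
  Q.1ℚ Q.* ℕtoℚ (length B)                 ≡⟨ Q.*-identityˡ (ℕtoℚ (length B)) ⟩
  ℕtoℚ (length B)                          ≤⟨ ℕtoℚ-mono (length-≤ (λ T → T) uniq-B
                                                (λ {T} T∈ → Equivalence.from (C-spec T) (proj₁ (Equivalence.to (B-spec T) T∈)))
                                                (λ _ _ eq → eq)) ⟩
  ℕtoℚ (length C)                          ∎
  where
  open Q.≤-Reasoning
  c = 2 * 1 * suc (suc d₁) ^ 1
  -- The right side of `hyp` is 0 here and the partial sum at 0 is 1, so q vanishes and the claim
  -- becomes |B| ≤ |C|.
  q≡0 : q ≡ Q.0ℚ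
  q≡0 = Q.≤-antisym (Q.*-cancelʳ-≤-pos (ℕtoℚ c) {{ℕtoℚ-pos {c} (s≤s z≤n)}}
    (Q.≤-trans (Q.≤-reflexive (sym (Q.*-identityʳ (q Q.* ℕtoℚ c)))) (Q.≤-trans (hyp 0) (Q.≤-reflexive (sym (Q.*-zeroˡ (ℕtoℚ c))))))) 0≤q
theorem1p7 (suc (suc d₁)) 1 _ _ (suc k) C _ _ [] _ _ q _ _ m =
  Q.≤-trans (Q.≤-reflexive (Q.*-zeroʳ (expPartial q m))) (0≤ℕtoℚ (length C))
theorem1p7 (suc (suc d₁)) 1 _ _ (suc k) C _ _ (leaf ∷ B) _ B-spec q _ _ m =
  contradiction (proj₁ (Equivalence.to (B-spec leaf) (here refl))) λ ()
theorem1p7 (suc (suc d₁)) 1 _ _ (suc k) C _ _ (node ts ∷ B) _ B-spec q _ _ m =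
  contradiction (perfect-1 ts) (proj₂ (Equivalence.to (B-spec (node ts)) (here refl)))
theorem1p7 0 _ () _
theorem1p7 1 _ (s≤s ()) _
theorem1p7 (suc (suc _)) 0 _ ()
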